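{- Let $q$ be an odd prime power, let $0\leqslant j\leqslant q-2$ and let $n$ be an integer with $2\leqslant n\leqslant 4$. Then the matrix $M(j,n,q,t)$ is diagonalizable over $\mathbb{C}_\infty$.
   Context: Let $q$ be a power of a prime $p$, and let $\mathbb{C}_\infty$ be the completion of an algebraic closure of $\mathbb{F}_q((1/t))$. For integers $0\leqslant j\leqslant q-2$ and $n\geqslant 1$, $M(j,n,q)=(m_{a,b})_{1\leqslant a,b\leqslant n}$ is the $n\times n$ matrix over $\mathbb{F}_p$ with entries (binomial coefficients reduced modulo $p$, with $\binom{x}{y}=0$ for integers $0\leqslant x<y$) $$m_{a,b}=-\left[\binom{j+(n-a)(q-1)}{j+(n-b)(q-1)}+(-1)^{j+1}\binom{j+(n-a)(q-1)}{j+(b-1)(q-1)}\right]\ \text{ if } a\neq b,\qquad m_{a,a}=(-1)^{j+2}\binom{j+(n-a)(q-1)}{j+(a-1)(q-1)}.$$ $M(j,n,q,t)$ is the $n\times n$ matrix over $\mathbb{F}_q[t]$ whose $(a,b)$ entry is $m_{a,b}\,t^{\,j+1+(b-1)(q-1)}$. (It is the matrix of the Atkin operator $U_t$, normalized by a power of $t$, acting on a block of $\Gamma_0(t)$-invariant Drinfeld cusp forms of weight $k=2j+2+(n-1)(q-1)$.) -}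

module Defs where

open import Level using (Level; _⊔_) renaming (suc to lsuc)
open import Algebra.Bundles using (CommutativeRing)
open import Algebra.Bundles.Raw using (RawRing)
import Algebra.Definitions
import Algebra.Definitions.RawSemiring
open import Algebra.Morphism.Structures using (module RingMorphisms)
open import Data.Fin using (Fin; toℕ; fromℕ; _≟_)
open import Data.Integer as ℤ using (ℤ; +_; -[1+_])
open import Data.Nat as ℕ using (ℕ; zero; suc; _∸_)
open import Data.Nat.Combinatorics using (_C_)
open import Data.Nat.Primality using (Prime)
open import Data.Product using (Σ; ∃; ∃-syntax; _×_; _,_)
open import Data.Rational as ℚ using (ℚ)
open import Data.Vec.Functional using (Vector)
open import Function.Bundles using (Inverse)
open import Relation.Binary.Construct.Add.Infimum.NonStrict ℚ._≤_ using (_≤₋_)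
open import Relation.Binary.PropositionalEquality as ≡ using (_≡_)
open import Relation.Nullary using (¬_; yes; no)
open import Relation.Nullary.Construct.Add.Infimum using (_₋; ⊥₋; [_])

IsPrimePower : ℕ → Set
IsPrimePower q = ∃[ p ] ∃[ e ] (Prime p × q ≡ p ℕ.^ suc e)

record Field (c ℓ : Level) : Set (lsuc (c ⊔ ℓ)) where
  field
    commutativeRing : CommutativeRing c ℓ
  open CommutativeRing commutativeRing public
  open RawRing rawRing public using (rawSemiring)
  open Algebra.Definitions _≈_ using (Invertible)
  field
    1≉0        : ¬ (1# ≈ 0#)
    invertible : ∀ {x} → ¬ (x ≈ 0#) → Invertible 1# _*_ x

HasCardinality : ∀ {c ℓ} → Field c ℓ → ℕ → Set (c ⊔ ℓ)
HasCardinality F q = Inverse (Field.setoid F) (≡.setoid (Fin q))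

------------------------------------------------------------------------
-- Matrices and polynomials over a field

module _ {c ℓ} (F : Field c ℓ) where
  open Field F
  open Algebra.Definitions.RawSemiring rawSemiring using (sum; _^_)

  Matrix : ℕ → Set c
  Matrix n = Fin n → Fin n → Carrier

  _≋_ : ∀ {n} → Matrix n → Matrix n → Set ℓ
  A ≋ B = ∀ a b → A a b ≈ B a b

  _⊗_ : ∀ {n} → Matrix n → Matrix n → Matrix n
  (A ⊗ B) a b = sum (λ i → A a i * B i b)

  diag : ∀ {n} → Vector Carrier n → Matrix n
  diag d a b with a ≟ b
  ... | yes _ = d a
  ... | no  _ = 0#

  𝟙 : ∀ {n} → Matrix n
  𝟙 = diag (λ _ → 1#)

  Diagonalizable : ∀ {n} → Matrix n → Set (c ⊔ ℓ)
  Diagonalizable {n} A =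
    Σ (Matrix n) λ P → Σ (Matrix n) λ P⁻¹ → Σ (Vector Carrier n) λ d →
      ((P ⊗ P⁻¹) ≋ 𝟙) × ((P⁻¹ ⊗ P) ≋ 𝟙) × (A ≋ ((P ⊗ diag d) ⊗ P⁻¹))

  -- The value at x of the polynomial with coefficients a, constant term first.
  eval : ∀ {n} → Vector Carrier n → Carrier → Carrier
  eval a x = sum (λ i → a i * (x ^ toℕ i))

  AlgebraicallyClosed : Set (c ⊔ ℓ)
  AlgebraicallyClosed =
    ∀ n (a : Vector Carrier (suc (suc n))) → ¬ (a (fromℕ (suc n)) ≈ 0#) →
    ∃[ x ] (eval a x ≈ 0#)

------------------------------------------------------------------------
-- The field F((1/t)) of Laurent series in 1/t

module _ {c ℓ} (F : Field c ℓ) where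
  open Field F
  open Algebra.Definitions.RawSemiring rawSemiring using (sum)

  -- The series  Σ_{i ≥ 0} (digit i) t^(top - i).  Leading digits may vanish,
  -- so equality is equality of all coefficients.
  record Laurent : Set c where
    constructor laurent
    field
      top   : ℤ
      digit : ℕ → Carrier

  open Laurent

  coeff : Laurent → ℤ → Carrier
  coeff f k with top f ℤ.- k
  ... | + i      = digit f i
  ... | -[1+ _ ] = 0#

  -- The monomial a t^k.
  monomial : Carrier → ℤ → Laurent
  monomial a k = laurent k λ { zero → a ; (suc _) → 0# }

  constant : Carrier → Laurent
  constant a = monomial a (+ 0)

  t : Laurent
  t = monomial 1# (+ 1)

  _+ᴸ_ : Laurent → Laurent → Laurent
  f +ᴸ g = laurent N λ i → coeff f (N ℤ.- + i) + coeff g (N ℤ.- + i)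
    where
    N : ℤ
    N = top f ℤ.⊔ top g

  _*ᴸ_ : Laurent → Laurent → Laurent
  f *ᴸ g = laurent (top f ℤ.+ top g) λ i →
    sum {suc i} (λ a → digit f (toℕ a) * digit g (i ∸ toℕ a))

  -ᴸ_ : Laurent → Laurent
  -ᴸ f = laurent (top f) (λ i → - digit f i)

  laurentRing : RawRing c ℓ
  laurentRing = record
    { Carrier = Laurent
    ; _≈_     = λ f g → ∀ k → coeff f k ≈ coeff g k
    ; _+_     = _+ᴸ_
    ; _*_     = _*ᴸ_
    ; -_      = -ᴸ_
    ; 0#      = constant 0#
    ; 1#      = constant 1#
    }

  HasDegree : Laurent → ℤ → Set ℓ
  HasDegree f k = ¬ (coeff f k ≈ 0#) × (∀ l → k ℤ.< l → coeff f l ≈ 0#)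

------------------------------------------------------------------------
-- Algebraic closures

record AlgebraicClosure {a m} (K : RawRing a m) (c ℓ : Level)
       : Set (a ⊔ m ⊔ lsuc (c ⊔ ℓ)) where
  private
    module K = RawRing K
  field
    closure : Field c ℓ
  open Field closure using (Carrier; _≈_; 0#; rawRing)
  field
    embed               : K.Carrier → Carrier
    isRingMonomorphism  : RingMorphisms.IsRingMonomorphism K rawRing embed
    algebraic           : ∀ x → ∃[ n ] Σ (Vector K.Carrier n) λ p →
                            (∃[ i ] ¬ (p i K.≈ K.0#)) ×
                            (eval closure (λ i → embed (p i)) x ≈ 0#)
    algebraicallyClosed : AlgebraicallyClosed closure

------------------------------------------------------------------------
-- Non-archimedean absolute values

_+₋_ : ℚ ₋ → ℚ ₋ → ℚ ₋
⊥₋    +₋ _     = ⊥₋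
[ _ ] +₋ ⊥₋    = ⊥₋
[ r ] +₋ [ s ] = [ r ℚ.+ s ]

-- An absolute value |·| with values in {0} ∪ q^ℚ, recorded by deg = log_q |·|,
-- where ⊥₋ stands for log_q 0 = -∞.  Rational exponents suffice: the value
-- group of an algebraic closure of F_q((1/t)), and of its completion, is q^ℚ.
record AbsoluteValue {c ℓ} (F : Field c ℓ) : Set (c ⊔ ℓ) where
  open Field F
  field
    deg      : Carrier → ℚ ₋
    deg-cong : ∀ {x y} → x ≈ y → deg x ≡ deg y
    deg-0    : deg 0# ≡ ⊥₋
    deg-⊥    : ∀ {x} → deg x ≡ ⊥₋ → x ≈ 0#
    deg-*    : ∀ x y → deg (x * y) ≡ deg x +₋ deg y
    deg-+    : ∀ {x y r} → deg x ≤₋ r → deg y ≤₋ r → deg (x + y) ≤₋ r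

  Cauchy : (ℕ → Carrier) → Set
  Cauchy x = ∀ (r : ℚ) → ∃[ N ] (∀ k l → N ℕ.≤ k → N ℕ.≤ l →
                                   deg (x k - x l) ≤₋ [ r ])

  _⟶_ : (ℕ → Carrier) → Carrier → Set
  x ⟶ y = ∀ (r : ℚ) → ∃[ N ] (∀ k → N ℕ.≤ k → deg (x k - y) ≤₋ [ r ])

  Complete : Set c
  Complete = ∀ x → Cauchy x → ∃[ y ] (x ⟶ y)

record Completion {a m} {F : Field a m} (V : AbsoluteValue F) (c ℓ : Level)
       : Set (a ⊔ m ⊔ lsuc (c ⊔ ℓ)) where
  private
    module F = Field F
  field
    completion    : Field c ℓ
    absoluteValue : AbsoluteValue completion
  open Field completion using (Carrier; _-_; rawRing)
  open AbsoluteValue absoluteValue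
  field
    embed              : F.Carrier → Carrier
    isRingMonomorphism : RingMorphisms.IsRingMonomorphism F.rawRing rawRing embed
    isometric          : ∀ x → deg (embed x) ≡ AbsoluteValue.deg V x
    dense              : ∀ x (r : ℚ) → ∃[ y ] (deg (x - embed y) ≤₋ [ r ])
    complete           : Complete

------------------------------------------------------------------------
-- ℂ∞ : the completion of an algebraic closure of F((1/t)), with respect to
-- the extension of the absolute value q^degree of F((1/t)).

record ℂ∞-Over {a m} (F : Field a m) (c₁ ℓ₁ c₂ ℓ₂ : Level)
       : Set (a ⊔ m ⊔ lsuc (c₁ ⊔ ℓ₁ ⊔ c₂ ⊔ ℓ₂)) where
  field
    algebraicClosure : AlgebraicClosure (laurentRing F) c₁ ℓ₁
  open AlgebraicClosure algebraicClosure using (closure)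
    renaming (embed to embedLaurent)
  field
    absoluteValue : AbsoluteValue closure
    extends       : ∀ f k → HasDegree F f k →
                    AbsoluteValue.deg absoluteValue (embedLaurent f) ≡ [ k ℚ./ 1 ]
    isCompletion  : Completion absoluteValue c₂ ℓ₂
  open Completion isCompletion using (embed) renaming (completion to ℂ∞) public

  ι : Laurent F → Field.Carrier ℂ∞
  ι f = embed (embedLaurent f)

------------------------------------------------------------------------
-- The matrices M(j,n,q) and M(j,n,q,t)

module _ {c ℓ} (F : Field c ℓ) where
  open Field F
  open Algebra.Definitions.RawSemiring rawSemiring using (_^_) renaming (_×_ to _·_)

  -- The binomial coefficient, reduced modulo the characteristic.
  binom : ℕ → ℕ → Carrier
  binom x y = (x C y) · 1#

  -- Rows and columns are indexed from 0: the indices a, b : Fin n stand for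
  -- the 1-based indices suc (toℕ a), suc (toℕ b).
  M[_,_,_] : (j n q : ℕ) → Matrix F n
  M[ j , n , q ] a b with a ≟ b
  ... | yes _ = ((- 1#) ^ (j ℕ.+ 2)) *
                binom (j ℕ.+ (n ∸ suc (toℕ a)) ℕ.* (q ∸ 1)) (j ℕ.+ toℕ a ℕ.* (q ∸ 1))
  ... | no  _ =
    - (binom (j ℕ.+ (n ∸ suc (toℕ a)) ℕ.* (q ∸ 1))
             (j ℕ.+ (n ∸ suc (toℕ b)) ℕ.* (q ∸ 1))
       + ((- 1#) ^ (j ℕ.+ 1)) *
         binom (j ℕ.+ (n ∸ suc (toℕ a)) ℕ.* (q ∸ 1)) (j ℕ.+ toℕ b ℕ.* (q ∸ 1)))

  private
    module L = RawRing (laurentRing F)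
    module P = Algebra.Definitions.RawSemiring L.rawSemiring

  -- The entries lie in F[t] ⊆ F((1/t)).
  M[_,_,_,t] : (j n q : ℕ) → Fin n → Fin n → Laurent F
  M[ j , n , q ,t] a b =
    constant F (M[ j , n , q ] a b) L.*
    (t F P.^ (j ℕ.+ 1 ℕ.+ toℕ b ℕ.* (q ∸ 1)))

{-# OPTIONS --safe #-}

-- By Lucas' theorem in base q, the entries of M(j,n,q) are integers depending
-- only on j and n.  Let s² = t and r = s^(q-1).  Then M(j,n,q,t) = t^(j+1) N(r)
-- for a matrix N over ℤ[X].  If j ≥ n - 1, then N is antidiagonal, with
-- eigenvalues ±X^(n-1); six pairs (n , j) remain.  In every case N has a basis of
-- eigenvectors over ℤ[X], and a power of 2 times a product of monic polynomials
-- clears the denominators of the inverse of the base change.  That product does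
-- not vanish at r, since q is odd and |r| > 1.

module Submission where

open import Defs
open import Algebra.Bundles using (CommutativeRing)
open import Algebra.Bundles.Raw using (RawRing)
import Algebra.Definitions.RawSemiring
import Algebra.Morphism.Construct.Composition as Composition
open import Algebra.Morphism.Structures using (module RingMorphisms)
import Algebra.Properties.Group
import Algebra.Solver.Ring
open import Algebra.Solver.Ring.AlmostCommutativeRing using (fromCommutativeRing; _-Raw-AlmostCommutative⟶_)
open import Data.Fin using (Fin; toℕ; _≟_; #_)
open import Data.Fin.Permutation using (Permutation; permutation)
open import Data.Fin.Properties using (toℕ<n)
open import Data.Integer as ℤ using (ℤ; +_; -[1+_]; 0ℤ; 1ℤ; -1ℤ)
import Data.Integer.Properties as ℤ
open import Data.List using (List; []; _∷_)
open import Data.Maybe using (Maybe; just; nothing; from-just; map)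
open import Data.Nat as ℕ using (ℕ; zero; suc; _≤_; _<_; _∸_; z≤n; s≤s; NonZero; nonTrivial⇒n>1)
open import Data.Nat.Combinatorics using (nCn≡1; k>n⇒nCk≡0; nCk+nC[k+1]≡[n+1]C[k+1])
  renaming (_C_ to _choose_)
open import Data.Nat.Coprimality as Coprime using (Coprime; coprime-divisor)
open import Data.Nat.Divisibility using (_∣_; divides; ∣-refl; ∣-trans; ∣⇒≤; _∣?_)
open import Data.Nat.Primality using (Prime; prime⇒irreducible; prime⇒nonTrivial; prime⇒nonZero)
import Data.Nat.Properties as ℕ
open import Data.Nat.Solver using (module +-*-Solver)
open import Data.Product using (∃-syntax; _×_; _,_; proj₁; proj₂)
open import Data.Rational as ℚ using (0ℚ)
import Data.Rational.Properties as ℚ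
open import Data.Sum using (_⊎_; inj₁; inj₂)
open import Data.Vec using (Vec; []; _∷_; lookup)
open import Function.Bundles using (Inverse)
open import Level using (Level; _⊔_)
open import Relation.Binary.Construct.Add.Infimum.NonStrict ℚ._≤_ using (_≤₋_; ⊥₋≤_; [_]; ≤₋-dec)
open import Relation.Binary.Definitions using (tri<; tri≈; tri>)
open import Relation.Binary.PropositionalEquality as ≡ using (_≡_)
open import Relation.Nullary using (¬_; Dec; yes; no; contradiction; dec⇒maybe)
open import Relation.Nullary.Construct.Add.Infimum using (⊥₋; [_]; []-injective)

-- The low base-q digit of j + k (q - 1) is j - k or, after a borrow, q - (k - j). Only the latter
-- involves q, and modulo p it acts like the negative integer j - k in a binomial coefficient whose
-- lower entry is below q. So q disappears from the entries, and identities over ℤ[X] settle all q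
-- at once.
--
-- The variable X is a square root of t^(q - 1) because of eigenvalues such as X and X^3. Since N
-- involves only u = X^2, the substitution X ↦ -X carries an eigenvector of X^3 to one of -X^3.
-- Eigenvalues can be multiple (for n = 4 and j ≥ 3 both X^3 and -X^3 are double), so distinct
-- eigenvalues cannot serve as the criterion and the bases are written out.
--
-- The denominators are not accidental: in each case Δ divides a product of differences of
-- eigenvalues, as eigenvectors can merge only where eigenvalues do. The 2 comes from X^k - (-X^k),
-- which is why odd q enters. Nonvanishing of the monic factors at r is insensitive to p, because
-- the image of ℤ has absolute value at most 1 and the leading term dominates.

private
  variable
    c ℓ : Level

-- Binomial coefficients modulo p

[1+k]*[1+n]C[1+k]≡[1+n]*nCk : ∀ n k → suc k ℕ.* (suc n choose suc k) ≡ suc n ℕ.* (n choose k)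
[1+k]*[1+n]C[1+k]≡[1+n]*nCk zero zero = ≡.refl
[1+k]*[1+n]C[1+k]≡[1+n]*nCk zero (suc k)
  rewrite k>n⇒nCk≡0 {1} {2 ℕ.+ k} (s≤s (s≤s z≤n)) | k>n⇒nCk≡0 {0} {suc k} (s≤s z≤n) = ℕ.*-zeroʳ k
[1+k]*[1+n]C[1+k]≡[1+n]*nCk (suc n) zero = begin
  1 ℕ.* (suc (suc n) choose 1)             ≡⟨ ≡.cong (1 ℕ.*_) (nCk+nC[k+1]≡[n+1]C[k+1] (suc n) 0) ⟨
  1 ℕ.* (1 ℕ.+ (suc n choose 1))           ≡⟨ ℕ.*-distribˡ-+ 1 1 (suc n choose 1) ⟩
  1 ℕ.+ 1 ℕ.* (suc n choose 1)             ≡⟨ ≡.cong (1 ℕ.+_) ([1+k]*[1+n]C[1+k]≡[1+n]*nCk n 0) ⟩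
  1 ℕ.+ suc n ℕ.* 1                   ∎
  where open ≡.≡-Reasoning
[1+k]*[1+n]C[1+k]≡[1+n]*nCk (suc n) (suc k) = begin
  suc (suc k) ℕ.* (suc (suc n) choose suc (suc k))
    ≡⟨ ≡.cong (suc (suc k) ℕ.*_) (nCk+nC[k+1]≡[n+1]C[k+1] (suc n) (suc k)) ⟨
  suc (suc k) ℕ.* (x ℕ.+ (suc n choose suc (suc k)))
    ≡⟨ solve 3 (λ k x y → (con 2 :+ k) :* (x :+ y) := x :+ (con 1 :+ k) :* x :+ (con 2 :+ k) :* y)
         ≡.refl k x (suc n choose suc (suc k)) ⟩
  x ℕ.+ suc k ℕ.* x ℕ.+ suc (suc k) ℕ.* (suc n choose suc (suc k))
    ≡⟨ ≡.cong₂ (λ y z → x ℕ.+ y ℕ.+ z) ([1+k]*[1+n]C[1+k]≡[1+n]*nCk n k)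
         ([1+k]*[1+n]C[1+k]≡[1+n]*nCk n (suc k)) ⟩
  x ℕ.+ suc n ℕ.* (n choose k) ℕ.+ suc n ℕ.* (n choose suc k)
    ≡⟨ solve 4 (λ n x y z → x :+ (con 1 :+ n) :* y :+ (con 1 :+ n) :* z := x :+ (con 1 :+ n) :* (y :+ z))
         ≡.refl n x (n choose k) (n choose suc k) ⟩
  x ℕ.+ suc n ℕ.* ((n choose k) ℕ.+ (n choose suc k))
    ≡⟨ ≡.cong (λ y → x ℕ.+ suc n ℕ.* y) (nCk+nC[k+1]≡[n+1]C[k+1] n k) ⟩
  suc (suc n) ℕ.* x ∎
  where
  open ≡.≡-Reasoning
  open +-*-Solver
  x = suc n choose suc k

-- A common divisor d of p^(e + 1) and m is coprime to p, since p does not divide m; hence d already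
-- divides p^e.
prime∤⇒coprime-^ : ∀ {p m} → Prime p → ¬ (p ∣ m) → ∀ e → Coprime (p ℕ.^ e) m
prime∤⇒coprime-^ pp p∤m zero    = Coprime.1-coprimeTo _
prime∤⇒coprime-^ {p} {m} pp p∤m (suc e) {d} (d∣pᵉ⁺¹ , d∣m) =
  prime∤⇒coprime-^ pp p∤m e (coprime-divisor d⊥p d∣pᵉ⁺¹ , d∣m)
  where
  d⊥p : Coprime d p
  d⊥p (x∣d , x∣p) with prime⇒irreducible pp x∣p
  ... | inj₁ x≡1    = x≡1
  ... | inj₂ ≡.refl = contradiction (∣-trans x∣d d∣m) p∤m

-- Absorption gives k C(p^e, k) = p^e C(p^e - 1, k - 1). If p did not divide C(p^e, k), then p^e
-- would be coprime to it and would divide the smaller number k.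
prime∣[p^e]Ck : ∀ {p} → Prime p → ∀ e {k} → 0 < k → k < p ℕ.^ e → p ∣ (p ℕ.^ e choose k)
prime∣[p^e]Ck {p} pp e {suc k} _ k<q with p ∣? (p ℕ.^ e choose suc k)
... | yes p∣C = p∣C
... | no  p∤C = contradiction (∣⇒≤ q∣k) (ℕ.<⇒≱ k<q)
  where
  q = p ℕ.^ e
  instance
    q≢0 : NonZero q
    q≢0 = ℕ.m^n≢0 p e {{prime⇒nonZero pp}}
  q-1 = ℕ.pred q
  absorption : suc k ℕ.* (q choose suc k) ≡ q ℕ.* (q-1 choose k)
  absorption = ≡.subst (λ n → suc k ℕ.* (n choose suc k) ≡ n ℕ.* (q-1 choose k))
    (ℕ.suc-pred q) ([1+k]*[1+n]C[1+k]≡[1+n]*nCk q-1 k)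
  q∣k : q ∣ suc k
  q∣k = coprime-divisor (prime∤⇒coprime-^ pp p∤C e)
    (divides (q-1 choose k) (≡.trans (ℕ.*-comm (q choose suc k) (suc k)) (≡.trans absorption (ℕ.*-comm q (q-1 choose k)))))

-- The image of ℤ in a commutative ring

module Integers (R : CommutativeRing c ℓ) where
  open CommutativeRing R
  open import Algebra.Properties.Ring ring
  open import Algebra.Properties.Semiring.Mult semiring using (×-homo-+; ×-homo-1; ×-congˡ)
    renaming (_×_ to _·_)
  open import Algebra.Properties.AbelianGroup +-abelianGroup using (⁻¹-∙-comm)
  open import Algebra.Properties.CommutativeSemigroup +-commutativeSemigroup using (interchange)
  open import Relation.Binary.Reasoning.Setoid setoid

  fromℤ : ℤ → Carrier
  fromℤ (+ n)    = n · 1#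
  fromℤ -[1+ n ] = - (suc n · 1#)

  fromℤ-cong : ∀ {i j} → i ≡ j → fromℤ i ≈ fromℤ j
  fromℤ-cong i≡j = reflexive (≡.cong fromℤ i≡j)

  fromℤ-1 : fromℤ 1ℤ ≈ 1#
  fromℤ-1 = ×-homo-1 1#

  fromℤ-neg : ∀ i → fromℤ (ℤ.- i) ≈ - fromℤ i
  fromℤ-neg (+ zero)  = sym -0#≈0#
  fromℤ-neg (+ suc n) = refl
  fromℤ-neg -[1+ n ]  = sym (-‿involutive _)

  fromℤ-⊖ : ∀ m n → fromℤ (m ℤ.⊖ n) ≈ m · 1# - n · 1#
  fromℤ-⊖ m       zero    = sym (trans (+-congˡ -0#≈0#) (+-identityʳ _))
  fromℤ-⊖ zero    (suc n) = sym (+-identityˡ _)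
  fromℤ-⊖ (suc m) (suc n) = begin
    fromℤ (suc m ℤ.⊖ suc n)               ≡⟨ ≡.cong fromℤ (ℤ.[1+m]⊖[1+n]≡m⊖n m n) ⟩
    fromℤ (m ℤ.⊖ n)                       ≈⟨ fromℤ-⊖ m n ⟩
    m · 1# - n · 1#                       ≈⟨ +-identityˡ _ ⟨
    0# + (m · 1# - n · 1#)                ≈⟨ +-congʳ (-‿inverseʳ 1#) ⟨
    (1# - 1#) + (m · 1# - n · 1#)         ≈⟨ interchange 1# (- 1#) (m · 1#) (- (n · 1#)) ⟩
    (1# + m · 1#) + (- 1# - n · 1#)       ≈⟨ +-congˡ (⁻¹-∙-comm 1# (n · 1#)) ⟩
    (1# + m · 1#) - (1# + n · 1#)         ∎

  fromℤ-+ : ∀ i j → fromℤ (i ℤ.+ j) ≈ fromℤ i + fromℤ j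
  fromℤ-+ (+ m)    (+ n)    = ×-homo-+ 1# m n
  fromℤ-+ (+ m)    -[1+ n ] = fromℤ-⊖ m (suc n)
  fromℤ-+ -[1+ m ] (+ n)    = trans (fromℤ-⊖ n (suc m)) (+-comm _ _)
  fromℤ-+ -[1+ m ] -[1+ n ] = begin
    - (suc (suc (m ℕ.+ n)) · 1#)        ≈⟨ -‿cong (×-congˡ (≡.cong suc (≡.sym (ℕ.+-suc m n)))) ⟩
    - ((suc m ℕ.+ suc n) · 1#)          ≈⟨ -‿cong (×-homo-+ 1# (suc m) (suc n)) ⟩
    - (suc m · 1# + suc n · 1#)         ≈⟨ ⁻¹-∙-comm _ _ ⟨
    - (suc m · 1#) - suc n · 1#         ∎

  private
    fromℤ-+* : ∀ m j → fromℤ (+ m ℤ.* j) ≈ fromℤ (+ m) * fromℤ j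
    fromℤ-+* zero    j = trans (fromℤ-cong (ℤ.*-zeroˡ j)) (sym (zeroˡ _))
    fromℤ-+* (suc m) j = begin
      fromℤ (+ suc m ℤ.* j)               ≡⟨ ≡.cong fromℤ (ℤ.suc-* (+ m) j) ⟩
      fromℤ (j ℤ.+ + m ℤ.* j)             ≈⟨ fromℤ-+ j (+ m ℤ.* j) ⟩
      fromℤ j + fromℤ (+ m ℤ.* j)         ≈⟨ +-cong (sym (*-identityˡ _)) (fromℤ-+* m j) ⟩
      1# * fromℤ j + m · 1# * fromℤ j     ≈⟨ distribʳ _ _ _ ⟨
      (1# + m · 1#) * fromℤ j             ∎

  fromℤ-* : ∀ i j → fromℤ (i ℤ.* j) ≈ fromℤ i * fromℤ j
  fromℤ-* (+ m)    j = fromℤ-+* m j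
  fromℤ-* -[1+ m ] j = begin
    fromℤ (-[1+ m ] ℤ.* j)                ≡⟨ ≡.cong fromℤ (ℤ.neg-distribˡ-* (+ suc m) j) ⟨
    fromℤ (ℤ.- (+ suc m ℤ.* j))           ≈⟨ fromℤ-neg (+ suc m ℤ.* j) ⟩
    - fromℤ (+ suc m ℤ.* j)               ≈⟨ -‿cong (fromℤ-+* (suc m) j) ⟩
    - (suc m · 1# * fromℤ j)              ≈⟨ -‿distribˡ-* _ _ ⟩
    - (suc m · 1#) * fromℤ j              ∎

-- Fields

module FieldProperties (F : Field c ℓ) where
  open Field F
  open import Relation.Binary.Reasoning.Setoid setoid
  open import Algebra.Properties.Semiring.Exp semiring using (_^_)

  *-cancelˡ-0 : ∀ {x y} → ¬ (x ≈ 0#) → x * y ≈ 0# → y ≈ 0#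
  *-cancelˡ-0 {x} {y} x≉0 xy≈0 with invertible x≉0
  ... | x⁻¹ , x⁻¹x≈1 , _ = begin
    y                ≈⟨ *-identityˡ y ⟨
    1# * y           ≈⟨ *-congʳ x⁻¹x≈1 ⟨
    x⁻¹ * x * y      ≈⟨ *-assoc x⁻¹ x y ⟩
    x⁻¹ * (x * y)    ≈⟨ *-congˡ xy≈0 ⟩
    x⁻¹ * 0#         ≈⟨ zeroʳ x⁻¹ ⟩
    0#               ∎

  *-nonzero : ∀ {x y} → ¬ (x ≈ 0#) → ¬ (y ≈ 0#) → ¬ (x * y ≈ 0#)
  *-nonzero x≉0 y≉0 xy≈0 = y≉0 (*-cancelˡ-0 x≉0 xy≈0)

  ^-nonzero : ∀ {x} → ¬ (x ≈ 0#) → ∀ n → ¬ (x ^ n ≈ 0#)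
  ^-nonzero x≉0 zero    = 1≉0
  ^-nonzero x≉0 (suc n) = *-nonzero x≉0 (^-nonzero x≉0 n)

2∣n⊎2∣1+n : ∀ n → 2 ∣ n ⊎ 2 ∣ suc n
2∣n⊎2∣1+n zero    = inj₁ (divides 0 ≡.refl)
2∣n⊎2∣1+n (suc n) with 2∣n⊎2∣1+n n
... | inj₁ (divides k ≡.refl) = inj₂ (divides (suc k) ≡.refl)
... | inj₂ 2∣1+n              = inj₁ 2∣1+n

module FiniteField (F : Field c ℓ) {q : ℕ} (F↔Fin : HasCardinality F q) where
  open Field F
  open FieldProperties F
  open Integers commutativeRing
  open import Algebra.Properties.Ring ring
  open import Algebra.Properties.CommutativeMonoid.Sum +-commutativeMonoid
    using (sum; sum-permute; sum-replicate; sum-cong-≋; ∑-distrib-+)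
  open import Algebra.Properties.Semiring.Mult semiring using (×1-homo-*)
    renaming (_×_ to _·_)
  open import Algebra.Properties.Semiring.Exp semiring using (_^_)
  open import Relation.Binary.Reasoning.Setoid setoid

  private
    module E = Inverse F↔Fin

  _≈?_ : ∀ x y → Dec (x ≈ y)
  x ≈? y with E.to x ≟ E.to y
  ... | yes eq = yes (trans (sym (E.inverseʳ ≡.refl)) (trans (E.from-cong eq) (E.inverseʳ ≡.refl)))
  ... | no neq = no λ x≈y → neq (E.to-cong x≈y)

  -- Translation by 1 permutes F, so summing all the elements gives Σ x = Σ (x + 1) = Σ x + q.
  q·1≈0 : q · 1# ≈ 0#
  q·1≈0 = +-cancelˡ (sum E.from) _ _ (begin
    sum E.from + q · 1#                           ≈⟨ +-congˡ (sum-replicate q) ⟨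
    sum E.from + sum {q} (λ _ → 1#)               ≈⟨ ∑-distrib-+ E.from (λ _ → 1#) ⟨
    sum {q} (λ i → E.from i + 1#)                 ≈⟨ sum-cong-≋ {q} (λ i → E.inverseʳ ≡.refl) ⟨
    sum {q} (λ i → E.from (E.to (E.from i + 1#))) ≈⟨ sum-permute E.from translation ⟨
    sum E.from                                    ≈⟨ +-identityʳ _ ⟨
    sum E.from + 0#                               ∎)
    where
    shift : Carrier → Fin q → Fin q
    shift a i = E.to (E.from i + a)
    shift-inverse : ∀ {a b} → a + b ≈ 0# → ∀ i → shift b (shift a i) ≡ i
    shift-inverse {a} {b} a+b≈0 i = E.inverseˡ (begin
      E.from (shift a i) + b   ≈⟨ +-congʳ (E.inverseʳ ≡.refl) ⟩
      E.from i + a + b         ≈⟨ +-assoc _ _ _ ⟩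
      E.from i + (a + b)       ≈⟨ +-congˡ a+b≈0 ⟩
      E.from i + 0#            ≈⟨ +-identityʳ _ ⟩
      E.from i                 ∎)
    translation : Permutation q q
    translation = permutation (shift 1#) (shift (- 1#))
      (shift-inverse (-‿inverseˡ 1#)) (shift-inverse (-‿inverseʳ 1#))

  m∣n⇒n·1≈0 : ∀ {m n} → m ∣ n → m · 1# ≈ 0# → n · 1# ≈ 0#
  m∣n⇒n·1≈0 {m} (divides k ≡.refl) m≈0 =
    trans (×1-homo-* k m) (trans (*-congˡ m≈0) (zeroʳ _))

  -- For odd q the number q + 1 is even, so 2 = 0 would give 1 = 1 + q = 0.
  2·1≉0 : ¬ (2 ∣ q) → ¬ (2 · 1# ≈ 0#)
  2·1≉0 2∤q 2≈0 with 2∣n⊎2∣1+n q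
  ... | inj₁ 2∣q   = 2∤q 2∣q
  ... | inj₂ 2∣1+q = 1≉0 (begin
    1#             ≈⟨ +-identityʳ 1# ⟨
    1# + 0#        ≈⟨ +-congˡ q·1≈0 ⟨
    suc q · 1#     ≈⟨ m∣n⇒n·1≈0 2∣1+q 2≈0 ⟩
    0#             ∎)

  [m^n]·1≈[m·1]^n : ∀ m n → (m ℕ.^ n) · 1# ≈ (m · 1#) ^ n
  [m^n]·1≈[m·1]^n m zero    = +-identityʳ 1#
  [m^n]·1≈[m·1]^n m (suc n) = trans (×1-homo-* m (m ℕ.^ n)) (*-congˡ ([m^n]·1≈[m·1]^n m n))

  -- A field has no nilpotents, and (p · 1)^e = q · 1 = 0. Equality is decidable through the
  -- enumeration of the field, which turns the refutation of p · 1 ≠ 0 into an equation.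
  p·1≈0 : ∀ {p} e → q ≡ p ℕ.^ e → p · 1# ≈ 0#
  p·1≈0 {p} e ≡.refl with (p · 1#) ≈? 0#
  ... | yes p≈0 = p≈0
  ... | no  p≉0 = contradiction (trans (sym ([m^n]·1≈[m·1]^n p e)) q·1≈0) (^-nonzero p≉0 e)

  binom-q-k≈0 : IsPrimePower q → ∀ {k} → 0 < k → k < q → binom F q k ≈ 0#
  binom-q-k≈0 (p , e , pp , ≡.refl) 0<k k<q =
    m∣n⇒n·1≈0 (prime∣[p^e]Ck pp (suc e) 0<k k<q) (p·1≈0 {p} (suc e) ≡.refl)

-- The binomial coefficient of -m over i.
negC : ℕ → ℕ → ℤ
negC m       zero    = 1ℤ
negC zero    (suc i) = 0ℤ
negC (suc m) (suc i) = negC m (suc i) ℤ.- negC (suc m) i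

-- The residue of the binomial coefficient of j + k (q - 1) over j + l (q - 1), see binom-blockC.
blockC : ℕ → ℕ → ℕ → ℤ
blockC j k l with k ℕ.≟ l | l ℕ.≤? j | j ℕ.<? k
... | yes _ | _     | _     = 1ℤ
... | no  _ | yes _ | yes _ = + (ℕ.pred k choose l) ℤ.* negC (k ∸ j) (j ∸ l)
... | no  _ | _     | _     = 0ℤ

-- Base-q digits of j + k (q - 1)

module Digits {q : ℕ} (0<q : 0 < q) (j : ℕ) where
  open ≡.≡-Reasoning

  private
    1+[q∸1]≡q : suc (q ∸ 1) ≡ q
    1+[q∸1]≡q = ℕ.m+[n∸m]≡n 0<q

  digits-≤ : ∀ {k} → k ≤ j → j ℕ.+ k ℕ.* (q ∸ 1) ≡ (j ∸ k) ℕ.+ k ℕ.* q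
  digits-≤ {k} k≤j = begin
    j ℕ.+ k ℕ.* s                  ≡⟨ ≡.cong (ℕ._+ k ℕ.* s) (ℕ.m∸n+n≡m k≤j) ⟨
    (j ∸ k) ℕ.+ k ℕ.+ k ℕ.* s      ≡⟨ ℕ.+-assoc (j ∸ k) k (k ℕ.* s) ⟩
    (j ∸ k) ℕ.+ (k ℕ.+ k ℕ.* s)    ≡⟨ ≡.cong ((j ∸ k) ℕ.+_) (ℕ.*-suc k s) ⟨
    (j ∸ k) ℕ.+ k ℕ.* suc s        ≡⟨ ≡.cong (λ x → (j ∸ k) ℕ.+ k ℕ.* x) 1+[q∸1]≡q ⟩
    (j ∸ k) ℕ.+ k ℕ.* q            ∎
    where
    s = q ∸ 1

  -- The low digit j - k would be negative, so one q is borrowed from k; k ≤ q keeps q - (k - j)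
  -- free of truncation. Adding k - j to both sides removes the outer subtraction.
  digits-> : ∀ {k} → j < k → k ≤ q → j ℕ.+ k ℕ.* (q ∸ 1) ≡ (q ∸ (k ∸ j)) ℕ.+ ℕ.pred k ℕ.* q
  digits-> {suc k} j<k k≤q = ℕ.+-cancelˡ-≡ (suc k ∸ j) _ _ (begin
    m ℕ.+ (j ℕ.+ suc k ℕ.* s)          ≡⟨ ℕ.+-assoc m j _ ⟨
    m ℕ.+ j ℕ.+ suc k ℕ.* s            ≡⟨ ≡.cong (ℕ._+ suc k ℕ.* s) (ℕ.m∸n+n≡m (ℕ.<⇒≤ j<k)) ⟩
    suc k ℕ.+ suc k ℕ.* s              ≡⟨ ℕ.*-suc (suc k) s ⟨
    suc k ℕ.* suc s                    ≡⟨ ≡.cong (suc k ℕ.*_) 1+[q∸1]≡q ⟩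
    q ℕ.+ k ℕ.* q                      ≡⟨ ≡.cong (ℕ._+ k ℕ.* q) (ℕ.m+[n∸m]≡n (ℕ.≤-trans (ℕ.m∸n≤m (suc k) j) k≤q)) ⟨
    m ℕ.+ (q ∸ m) ℕ.+ k ℕ.* q          ≡⟨ ℕ.+-assoc m _ _ ⟩
    m ℕ.+ ((q ∸ m) ℕ.+ k ℕ.* q)        ∎)
    where
    s = q ∸ 1
    m = suc k ∸ j

-- The matrix M(j,n,q), which does not depend on q; σ stands for (-1)^j.
Mℤ : (j n : ℕ) → ℤ → Fin n → Fin n → ℤ
Mℤ j n σ a b with a ≟ b
... | yes _ = σ ℤ.* blockC j (n ∸ suc (toℕ a)) (toℕ a)
... | no  _ = ℤ.- (blockC j (n ∸ suc (toℕ a)) (n ∸ suc (toℕ b)) ℤ.+ ℤ.- σ ℤ.* blockC j (n ∸ suc (toℕ a)) (toℕ b))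

[-1]^n≡±1 : ∀ n → -1ℤ ℤ.^ n ≡ 1ℤ ⊎ -1ℤ ℤ.^ n ≡ -1ℤ
[-1]^n≡±1 zero    = inj₁ ≡.refl
[-1]^n≡±1 (suc n) with [-1]^n≡±1 n
... | inj₁ eq = inj₂ (≡.cong (-1ℤ ℤ.*_) eq)
... | inj₂ eq = inj₁ (≡.cong (-1ℤ ℤ.*_) eq)

-- Lucas' theorem in base q and the entries of the matrix

module LucasTheorem (F : Field c ℓ) (q : ℕ) (0<q : 0 < q)
  (binom-q-k≈0 : ∀ {k} → 0 < k → k < q → Field._≈_ F (binom F q k) (Field.0# F)) where
  open Field F hiding (zero)
  open Integers commutativeRing
  open import Algebra.Properties.Ring ring
  open import Algebra.Properties.Semiring.Mult semiring
    using (×-homo-+; ×-homo-1; ×-congˡ)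
    renaming (_×_ to _·_)
  open import Algebra.Properties.Semiring.Exp semiring using (_^_; ^-homo-*)
  open import Algebra.Properties.CommutativeSemigroup +-commutativeSemigroup using (interchange)
  open import Relation.Binary.Reasoning.Setoid setoid

  pascal : ∀ n k → binom F (suc n) (suc k) ≈ binom F n k + binom F n (suc k)
  pascal n k = trans (×-congˡ (≡.sym (nCk+nC[k+1]≡[n+1]C[k+1] n k))) (×-homo-+ 1# (n choose k) (n choose suc k))

  binom-< : ∀ {n k} → n < k → binom F n k ≈ 0#
  binom-< n<k = ×-congˡ (k>n⇒nCk≡0 n<k)

  binom-refl : ∀ n → binom F n n ≈ 1#
  binom-refl n = trans (×-congˡ (nCn≡1 n)) (×-homo-1 1#)

  -- The hypothesis amounts to (1 + x)^q = 1 + x^q, so (1 + x)^(n + q) = (1 + x)^n + x^q (1 + x)^n.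
  -- Below degree q only the first summand contributes; `binom-+q-≥` reads off the other degrees.
  binom-+q-< : ∀ n {k} → k < q → binom F (n ℕ.+ q) k ≈ binom F n k
  binom-+q-< zero    {zero}  _   = refl
  binom-+q-< zero    {suc k} k<q = trans (binom-q-k≈0 (s≤s z≤n) k<q) (sym (binom-< {0} {suc k} (s≤s z≤n)))
  binom-+q-< (suc n) {zero}  _   = refl
  binom-+q-< (suc n) {suc k} k<q = begin
    binom F (suc n ℕ.+ q) (suc k)                    ≈⟨ pascal (n ℕ.+ q) k ⟩
    binom F (n ℕ.+ q) k + binom F (n ℕ.+ q) (suc k)  ≈⟨ +-cong (binom-+q-< n (ℕ.<⇒≤ k<q)) (binom-+q-< n k<q) ⟩
    binom F n k + binom F n (suc k)                  ≈⟨ pascal n k ⟨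
    binom F (suc n) (suc k)                          ∎

  binom-+q-≥ : ∀ n k → binom F (n ℕ.+ q) (k ℕ.+ q) ≈ binom F n (k ℕ.+ q) + binom F n k
  binom-+q-≥ zero zero = begin
    binom F q q                  ≈⟨ binom-refl q ⟩
    1#                           ≈⟨ +-identityˡ 1# ⟨
    0# + 1#                      ≈⟨ +-cong (binom-< 0<q) (binom-refl 0) ⟨
    binom F 0 q + binom F 0 0    ∎
  binom-+q-≥ zero (suc k) = begin
    binom F q (suc k ℕ.+ q)                       ≈⟨ binom-< (s≤s (ℕ.m≤n+m q k)) ⟩
    0#                                            ≈⟨ +-identityˡ 0# ⟨
    0# + 0#                                       ≈⟨ +-cong (binom-< {0} {suc k ℕ.+ q} (s≤s z≤n)) (binom-< {0} {suc k} (s≤s z≤n)) ⟨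
    binom F 0 (suc k ℕ.+ q) + binom F 0 (suc k)   ∎
  binom-+q-≥ (suc n) zero = begin
    binom F (suc n ℕ.+ q) q                                ≡⟨ ≡.cong (binom F (suc n ℕ.+ q)) 1+q-1≡q ⟨
    binom F (suc n ℕ.+ q) (suc q-1)                        ≈⟨ pascal (n ℕ.+ q) q-1 ⟩
    -- Pascal's rule leaves the range of this lemma: the lower entry q - 1 is below q and belongs to
    -- `binom-+q-<`.
    binom F (n ℕ.+ q) q-1 + binom F (n ℕ.+ q) (suc q-1)    ≈⟨ +-cong (binom-+q-< n (ℕ.≤-reflexive 1+q-1≡q)) (reflexive (≡.cong (binom F (n ℕ.+ q)) 1+q-1≡q)) ⟩
    binom F n q-1 + binom F (n ℕ.+ q) q                    ≈⟨ +-congˡ (binom-+q-≥ n zero) ⟩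
    binom F n q-1 + (binom F n q + binom F n 0)            ≈⟨ +-assoc _ _ _ ⟨
    (binom F n q-1 + binom F n q) + 1 · 1#                 ≡⟨ ≡.cong (λ x → binom F n q-1 + binom F n x + 1 · 1#) 1+q-1≡q ⟨
    (binom F n q-1 + binom F n (suc q-1)) + 1 · 1#         ≈⟨ +-congʳ (pascal n q-1) ⟨
    binom F (suc n) (suc q-1) + 1 · 1#                     ≡⟨ ≡.cong (λ x → binom F (suc n) x + 1 · 1#) 1+q-1≡q ⟩
    binom F (suc n) q + binom F (suc n) 0                  ∎
    where
    q-1 = ℕ.pred q
    1+q-1≡q : suc q-1 ≡ q
    1+q-1≡q = ℕ.suc-pred q {{ℕ.>-nonZero 0<q}}
  binom-+q-≥ (suc n) (suc k) = begin
    binom F (suc n ℕ.+ q) (suc k ℕ.+ q)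
      ≈⟨ pascal (n ℕ.+ q) (k ℕ.+ q) ⟩
    binom F (n ℕ.+ q) (k ℕ.+ q) + binom F (n ℕ.+ q) (suc k ℕ.+ q)
      ≈⟨ +-cong (binom-+q-≥ n k) (binom-+q-≥ n (suc k)) ⟩
    (binom F n (k ℕ.+ q) + binom F n k) + (binom F n (suc k ℕ.+ q) + binom F n (suc k))
      ≈⟨ interchange _ _ _ _ ⟩
    (binom F n (k ℕ.+ q) + binom F n (suc k ℕ.+ q)) + (binom F n k + binom F n (suc k))
      ≈⟨ +-cong (pascal n (k ℕ.+ q)) (pascal n k) ⟨
    binom F (suc n) (suc k ℕ.+ q) + binom F (suc n) (suc k) ∎

  private
    +-suc* : ∀ r k → r ℕ.+ suc k ℕ.* q ≡ r ℕ.+ k ℕ.* q ℕ.+ q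
    +-suc* r k = ≡.trans (≡.cong (r ℕ.+_) (ℕ.+-comm q (k ℕ.* q))) (≡.sym (ℕ.+-assoc r (k ℕ.* q) q))

  -- Only the lowest base-q digit is split off and k, l are arbitrary. Removing q from the upper
  -- entry is Pascal's rule for C(k + 1, l + 1), multiplied by the unchanged factor C(r, r′).
  lucas : ∀ {r r′} → r < q → r′ < q → ∀ k l →
          binom F (r ℕ.+ k ℕ.* q) (r′ ℕ.+ l ℕ.* q) ≈ binom F k l * binom F r r′
  lucas {r} {r′} r<q r′<q zero zero
    rewrite ℕ.+-identityʳ r | ℕ.+-identityʳ r′ = sym (trans (*-congʳ (×-homo-1 1#)) (*-identityˡ _))
  lucas {r} {r′} r<q r′<q zero (suc l) rewrite ℕ.+-identityʳ r =
    trans (binom-< (ℕ.<-≤-trans r<q (ℕ.≤-trans (ℕ.m≤m+n q (l ℕ.* q)) (ℕ.m≤n+m _ r′))))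
      (sym (trans (*-congʳ (binom-< {0} {suc l} (s≤s z≤n))) (zeroˡ _)))
  lucas {r} {r′} r<q r′<q (suc k) zero = begin
    binom F (r ℕ.+ suc k ℕ.* q) (r′ ℕ.+ 0)       ≡⟨ ≡.cong (λ x → binom F x (r′ ℕ.+ 0)) (+-suc* r k) ⟩
    binom F (r ℕ.+ k ℕ.* q ℕ.+ q) (r′ ℕ.+ 0)     ≈⟨ binom-+q-< (r ℕ.+ k ℕ.* q) (≡.subst (_< q) (≡.sym (ℕ.+-identityʳ r′)) r′<q) ⟩
    binom F (r ℕ.+ k ℕ.* q) (r′ ℕ.+ 0)           ≈⟨ lucas r<q r′<q k zero ⟩
    binom F k 0 * binom F r r′                   ∎
  lucas {r} {r′} r<q r′<q (suc k) (suc l) = begin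
    binom F (r ℕ.+ suc k ℕ.* q) (r′ ℕ.+ suc l ℕ.* q)
      ≡⟨ ≡.cong₂ (binom F) (+-suc* r k) (+-suc* r′ l) ⟩
    binom F (r ℕ.+ k ℕ.* q ℕ.+ q) (r′ ℕ.+ l ℕ.* q ℕ.+ q)
      ≈⟨ binom-+q-≥ (r ℕ.+ k ℕ.* q) (r′ ℕ.+ l ℕ.* q) ⟩
    binom F (r ℕ.+ k ℕ.* q) (r′ ℕ.+ l ℕ.* q ℕ.+ q) + binom F (r ℕ.+ k ℕ.* q) (r′ ℕ.+ l ℕ.* q)
      ≡⟨ ≡.cong (λ x → binom F (r ℕ.+ k ℕ.* q) x + binom F (r ℕ.+ k ℕ.* q) (r′ ℕ.+ l ℕ.* q)) (+-suc* r′ l) ⟨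
    binom F (r ℕ.+ k ℕ.* q) (r′ ℕ.+ suc l ℕ.* q) + binom F (r ℕ.+ k ℕ.* q) (r′ ℕ.+ l ℕ.* q)
      ≈⟨ +-cong (lucas r<q r′<q k (suc l)) (lucas r<q r′<q k l) ⟩
    binom F k (suc l) * binom F r r′ + binom F k l * binom F r r′
      ≈⟨ distribʳ _ _ _ ⟨
    (binom F k (suc l) + binom F k l) * binom F r r′
      ≈⟨ *-congʳ (trans (+-comm _ _) (sym (pascal k l))) ⟩
    binom F (suc k) (suc l) * binom F r r′ ∎

  -- This is x = q - m acting as -m. For m = 0 the vanishing of C(q, i) agrees with C(0, i), and the
  -- step is Pascal's rule solved for C(x, i + 1), the recursion of `negC`. The bound is sharp: C(q,
  -- q) = 1 while C(0, q) = 0.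
  binom-neg : ∀ m {x i} → m ℕ.+ x ≡ q → i < q → binom F x i ≈ fromℤ (negC m i)
  binom-neg zero    {i = zero}  _      _   = refl
  binom-neg (suc m) {i = zero}  _      _   = refl
  binom-neg zero    {i = suc i} ≡.refl i<q = binom-q-k≈0 (s≤s z≤n) i<q
  binom-neg (suc m) {x} {suc i} m+x≡q  i<q = begin
    binom F x (suc i)
      ≈⟨ +-identityʳ _ ⟨
    binom F x (suc i) + 0#
      ≈⟨ +-congˡ (-‿inverseʳ (binom F x i)) ⟨
    binom F x (suc i) + (binom F x i - binom F x i)
      ≈⟨ +-assoc _ _ _ ⟨
    binom F x (suc i) + binom F x i - binom F x i
      ≈⟨ +-congʳ (trans (+-comm _ _) (sym (pascal x i))) ⟩
    binom F (suc x) (suc i) - binom F x i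
      ≈⟨ +-cong (binom-neg m (≡.trans (ℕ.+-suc m x) m+x≡q) i<q) (-‿cong (binom-neg (suc m) m+x≡q (ℕ.<⇒≤ i<q))) ⟩
    fromℤ (negC m (suc i)) - fromℤ (negC (suc m) i)
      ≈⟨ +-congˡ (fromℤ-neg (negC (suc m) i)) ⟨
    fromℤ (negC m (suc i)) + fromℤ (ℤ.- negC (suc m) i)
      ≈⟨ fromℤ-+ (negC m (suc i)) _ ⟨
    fromℤ (negC (suc m) (suc i)) ∎

  module _ {j : ℕ} (2+j≤q : 2 ℕ.+ j ≤ q) where
    open Digits 0<q j
    private
      X : ℕ → ℕ
      X k = j ℕ.+ k ℕ.* (q ∸ 1)

      j<q : j < q
      j<q = ℕ.<⇒≤ 2+j≤q

      X-mono-< : ∀ {k l} → k < l → X k < X l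
      X-mono-< k<l = ℕ.+-monoʳ-< j (ℕ.*-monoˡ-< (q ∸ 1) {{q∸1≢0}} k<l)
        where
        q∸1≢0 : NonZero (q ∸ 1)
        q∸1≢0 = ℕ.>-nonZero (ℕ.∸-monoˡ-≤ 1 (ℕ.≤-trans (ℕ.m≤m+n 2 j) 2+j≤q))

      ∸-<-q : ∀ {k} → j < k → k ≤ q → q ∸ (k ∸ j) < q
      ∸-<-q j<k k≤q = ℕ.∸-monoʳ-< (ℕ.m<n⇒0<n∸m j<k) (ℕ.≤-trans (ℕ.m∸n≤m _ j) k≤q)

      lucas-0 : ∀ {x y r r′ k l} → x ≡ r ℕ.+ k ℕ.* q → y ≡ r′ ℕ.+ l ℕ.* q →
                r < r′ → r′ < q → binom F x y ≈ 0#
      lucas-0 {k = k} {l} ≡.refl ≡.refl r<r′ r′<q =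
        trans (lucas (ℕ.<-trans r<r′ r′<q) r′<q k l) (trans (*-congˡ (binom-< r<r′)) (zeroʳ _))

    -- Off the diagonal there are two sources of zeros: for k < l the upper entry is the smaller
    -- one, and for l < k with both or neither of the entries borrowing, the low digit above is
    -- smaller than the one below. What survives is l ≤ j < k, where only the upper entry borrows.
    binom-blockC : ∀ {k l} → k ≤ q → l ≤ q → binom F (X k) (X l) ≈ fromℤ (blockC j k l)
    binom-blockC {k} {l} k≤q l≤q with k ℕ.≟ l | l ℕ.≤? j | j ℕ.<? k
    ... | yes ≡.refl | _ | _ = trans (binom-refl (X k)) (sym fromℤ-1)
    ... | no _ | yes l≤j | yes j<k = begin
      binom F (X k) (X l)
        ≡⟨ ≡.cong₂ (binom F) (digits-> j<k k≤q) (digits-≤ l≤j) ⟩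
      binom F ((q ∸ (k ∸ j)) ℕ.+ ℕ.pred k ℕ.* q) ((j ∸ l) ℕ.+ l ℕ.* q)
        ≈⟨ lucas (∸-<-q j<k k≤q) j∸l<q (ℕ.pred k) l ⟩
      binom F (ℕ.pred k) l * binom F (q ∸ (k ∸ j)) (j ∸ l)
        ≈⟨ *-congˡ (binom-neg (k ∸ j) (ℕ.m+[n∸m]≡n (ℕ.≤-trans (ℕ.m∸n≤m k j) k≤q)) j∸l<q) ⟩
      fromℤ (+ (ℕ.pred k choose l)) * fromℤ (negC (k ∸ j) (j ∸ l))
        ≈⟨ fromℤ-* (+ (ℕ.pred k choose l)) (negC (k ∸ j) (j ∸ l)) ⟨
      fromℤ (+ (ℕ.pred k choose l) ℤ.* negC (k ∸ j) (j ∸ l)) ∎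
      where
      j∸l<q : j ∸ l < q
      j∸l<q = ℕ.≤-<-trans (ℕ.m∸n≤m j l) j<q
    ... | no k≢l | yes l≤j | no j≮k with ℕ.<-cmp k l
    ...   | tri< k<l _ _ = binom-< (X-mono-< k<l)
    ...   | tri≈ _ k≡l _ = contradiction k≡l k≢l
    ...   | tri> _ _ l<k = lucas-0 {k = k} {l} (digits-≤ k≤j) (digits-≤ l≤j) (ℕ.∸-monoʳ-< l<k k≤j) (ℕ.≤-<-trans (ℕ.m∸n≤m j l) j<q)
      where
      k≤j : k ≤ j
      k≤j = ℕ.≮⇒≥ j≮k
    binom-blockC {k} {l} k≤q l≤q | no k≢l | no l≰j | _ with ℕ.<-cmp k l
    ...   | tri< k<l _ _ = binom-< (X-mono-< k<l)
    ...   | tri≈ _ k≡l _ = contradiction k≡l k≢l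
    ...   | tri> _ _ l<k = lucas-0 {k = ℕ.pred k} {ℕ.pred l} (digits-> j<k k≤q) (digits-> j<l l≤q)
        (ℕ.∸-monoʳ-< (ℕ.∸-monoˡ-< l<k (ℕ.<⇒≤ j<l)) (ℕ.≤-trans (ℕ.m∸n≤m k j) k≤q)) (∸-<-q j<l l≤q)
      where
      j<l : j < l
      j<l = ℕ.≰⇒> l≰j
      j<k : j < k
      j<k = ℕ.<-trans j<l l<k

    private
      x*[-1]≈-x : ∀ x → x * - 1# ≈ - x
      x*[-1]≈-x x = trans (sym (-‿distribʳ-* x 1#)) (-‿cong (*-identityʳ x))

      module Exponents {n σ} (n≤1+q : n ≤ suc q) ([-1]^j≈σ : (- 1#) ^ j ≈ fromℤ σ) where
        n∸1+ : Fin n → ℕ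
        n∸1+ a = n ∸ suc (toℕ a)

        n∸1+≤q : ∀ a → n∸1+ a ≤ q
        n∸1+≤q a = ℕ.≤-trans (ℕ.∸-monoˡ-≤ (suc (toℕ a)) n≤1+q) (ℕ.m∸n≤m q (toℕ a))

        toℕ≤q : (a : Fin n) → toℕ a ≤ q
        toℕ≤q a = ℕ.s≤s⁻¹ (ℕ.<-≤-trans (toℕ<n a) n≤1+q)

        [-1]^[j+1]≈-σ : (- 1#) ^ (j ℕ.+ 1) ≈ fromℤ (ℤ.- σ)
        [-1]^[j+1]≈-σ = begin
          (- 1#) ^ (j ℕ.+ 1)               ≈⟨ ^-homo-* (- 1#) j 1 ⟩
          (- 1#) ^ j * (- 1# * 1#)         ≈⟨ *-congˡ (*-identityʳ _) ⟩
          (- 1#) ^ j * - 1#                ≈⟨ x*[-1]≈-x _ ⟩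
          - ((- 1#) ^ j)                   ≈⟨ -‿cong [-1]^j≈σ ⟩
          - fromℤ σ                        ≈⟨ fromℤ-neg σ ⟨
          fromℤ (ℤ.- σ)                    ∎

        [-1]^[j+2]≈σ : (- 1#) ^ (j ℕ.+ 2) ≈ fromℤ σ
        [-1]^[j+2]≈σ = begin
          (- 1#) ^ (j ℕ.+ 2)               ≈⟨ ^-homo-* (- 1#) j 2 ⟩
          (- 1#) ^ j * (- 1# * (- 1# * 1#)) ≈⟨ *-congˡ (*-congˡ (*-identityʳ _)) ⟩
          (- 1#) ^ j * (- 1# * - 1#)       ≈⟨ *-congˡ (x*[-1]≈-x (- 1#)) ⟩
          (- 1#) ^ j * - - 1#              ≈⟨ *-cong [-1]^j≈σ (-‿involutive 1#) ⟩
          fromℤ σ * 1#                     ≈⟨ *-identityʳ _ ⟩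
          fromℤ σ                          ∎

    M≈Mℤ : ∀ {n σ} → n ≤ suc q → (- 1#) ^ j ≈ fromℤ σ →
           ∀ a b → M[_,_,_] F j n q a b ≈ fromℤ (Mℤ j n σ a b)
    M≈Mℤ {n} {σ} n≤1+q [-1]^j≈σ a b with a ≟ b
    ... | yes _ = begin
      (- 1#) ^ (j ℕ.+ 2) * binom F (X (n∸1+ a)) (X (toℕ a))
        ≈⟨ *-cong [-1]^[j+2]≈σ (binom-blockC (n∸1+≤q a) (toℕ≤q a)) ⟩
      fromℤ σ * fromℤ (blockC j (n∸1+ a) (toℕ a))
        ≈⟨ fromℤ-* σ (blockC j (n∸1+ a) (toℕ a)) ⟨
      fromℤ (σ ℤ.* blockC j (n∸1+ a) (toℕ a)) ∎
      where
      open Exponents {σ = σ} n≤1+q [-1]^j≈σ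
    ... | no _ = begin
      - (binom F (X (n∸1+ a)) (X (n∸1+ b)) + (- 1#) ^ (j ℕ.+ 1) * binom F (X (n∸1+ a)) (X (toℕ b)))
        ≈⟨ -‿cong (+-cong (binom-blockC (n∸1+≤q a) (n∸1+≤q b)) (*-cong [-1]^[j+1]≈-σ (binom-blockC (n∸1+≤q a) (toℕ≤q b)))) ⟩
      - (fromℤ x + fromℤ (ℤ.- σ) * fromℤ y)
        ≈⟨ -‿cong (+-congˡ (fromℤ-* (ℤ.- σ) y)) ⟨
      - (fromℤ x + fromℤ (ℤ.- σ ℤ.* y))
        ≈⟨ -‿cong (fromℤ-+ x (ℤ.- σ ℤ.* y)) ⟨
      - fromℤ (x ℤ.+ ℤ.- σ ℤ.* y)
        ≈⟨ fromℤ-neg (x ℤ.+ ℤ.- σ ℤ.* y) ⟨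
      fromℤ (ℤ.- (x ℤ.+ ℤ.- σ ℤ.* y)) ∎
      where
      open Exponents {σ = σ} n≤1+q [-1]^j≈σ
      x y : ℤ
      x = blockC j (n∸1+ a) (n∸1+ b)
      y = blockC j (n∸1+ a) (toℕ b)

  [-1]^n≈fromℤ : ∀ n → (- 1#) ^ n ≈ fromℤ (-1ℤ ℤ.^ n)
  [-1]^n≈fromℤ zero    = sym fromℤ-1
  [-1]^n≈fromℤ (suc n) = begin
    - 1# * (- 1#) ^ n                 ≈⟨ *-cong (-‿cong (sym fromℤ-1)) ([-1]^n≈fromℤ n) ⟩
    fromℤ -1ℤ * fromℤ (-1ℤ ℤ.^ n)     ≈⟨ fromℤ-* -1ℤ (-1ℤ ℤ.^ n) ⟨
    fromℤ (-1ℤ ℤ.* -1ℤ ℤ.^ n)         ∎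

-- Diagonalization over ℤ[X]

everywhere : ∀ {p n} {P : Fin n → Set p} → (∀ i → Maybe (P i)) → Maybe (∀ i → P i)
everywhere {n = zero}  P? = just λ ()
everywhere {n = suc n} P? with P? Fin.zero | everywhere (λ i → P? (Fin.suc i))
... | just p | just ps = just λ { Fin.zero → p ; (Fin.suc i) → ps i }
... | _      | _       = nothing

module IntegerPolynomials (F : Field c ℓ) where
  open Field F hiding (zero)
  open Integers commutativeRing
  open import Algebra.Properties.Semiring.Sum semiring using (sum)

  private
    morphism : CommutativeRing.rawRing ℤ.+-*-commutativeRing -Raw-AlmostCommutative⟶ fromCommutativeRing commutativeRing
    morphism = record
      { ⟦_⟧    = fromℤ
      ; +-homo = fromℤ-+
      ; *-homo = fromℤ-*
      ; -‿homo = fromℤ-neg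
      ; 0-homo = refl
      ; 1-homo = fromℤ-1
      }

  open Algebra.Solver.Ring _ (fromCommutativeRing commutativeRing) morphism
    (λ i j → map fromℤ-cong (dec⇒maybe (i ℤ.≟ j)))

  ℤ[X] : Set
  ℤ[X] = Polynomial 1

  X : ℤ[X]
  X = var (# 0)

  infix 9 _⟨_⟩
  _⟨_⟩ : ℤ[X] → Carrier → Carrier
  p ⟨ r ⟩ = ⟦ p ⟧ (r ∷ [])

  PolyMatrix : ℕ → Set
  PolyMatrix n = Fin n → Fin n → ℤ[X]

  -- It follows the recursion of `sum`, and `con 0ℤ` evaluates to `0#` by computation, so evaluation
  -- commutes with sums up to propositional equality.
  sumP : ∀ {n} → (Fin n → ℤ[X]) → ℤ[X]
  sumP {zero}  p = con 0ℤ
  sumP {suc n} p = p Fin.zero :+ sumP (λ i → p (Fin.suc i))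

  sumP-eval : ∀ {n} (p : Fin n → ℤ[X]) r → sumP p ⟨ r ⟩ ≡ sum (λ i → p i ⟨ r ⟩)
  sumP-eval {zero}  p r = ≡.refl
  sumP-eval {suc n} p r = ≡.cong (p Fin.zero ⟨ r ⟩ +_) (sumP-eval (λ i → p (Fin.suc i)) r)

  _⊗P_ : ∀ {n} → PolyMatrix n → PolyMatrix n → PolyMatrix n
  (A ⊗P B) a b = sumP (λ i → A a i :* B i b)

  diagP : ∀ {n} → (Fin n → ℤ[X]) → PolyMatrix n
  diagP d a b with a ≟ b
  ... | yes _ = d a
  ... | no  _ = con 0ℤ

  _⟪_⟫ : ∀ {n} → PolyMatrix n → Carrier → Matrix F n
  (A ⟪ r ⟫) a b = A a b ⟨ r ⟩

  ⊗P-eval : ∀ {n} (A B : PolyMatrix n) r a b → ((A ⊗P B) ⟪ r ⟫) a b ≡ (_⊗_ F (A ⟪ r ⟫) (B ⟪ r ⟫)) a b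
  ⊗P-eval A B r a b = sumP-eval (λ i → A a i :* B i b) r

  diagP-eval : ∀ {n} (d : Fin n → ℤ[X]) r a b → (diagP d ⟪ r ⟫) a b ≡ diag F (λ i → d i ⟨ r ⟩) a b
  diagP-eval d r a b with a ≟ b
  ... | yes _ = ≡.refl
  ... | no  _ = ≡.refl

  _≋P_ : ∀ {n} → PolyMatrix n → PolyMatrix n → Set (c ⊔ ℓ)
  A ≋P B = ∀ a b r → A a b ⟨ r ⟩ ≈ B a b ⟨ r ⟩

  -- Normal forms are compared through their integer coefficients, so an answer `just` rests on an
  -- identity over ℤ and is independent of the characteristic of F.
  _≋P?_ : ∀ {n} (A B : PolyMatrix n) → Maybe (A ≋P B)
  A ≋P? B = everywhere λ a → everywhere λ b →
    map (λ eq r → prove (r ∷ []) (A a b) (B a b) (⟦ eq ⟧N-cong (r ∷ [])))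
      (normalise (A a b) ≟N normalise (B a b))

  -- monic (a₀ ∷ … ∷ aₘ₋₁ ∷ []) = a₀ + … + aₘ₋₁ Xᵐ⁻¹ + Xᵐ.
  monic : List ℤ → ℤ[X]
  monic []       = con 1ℤ
  monic (a ∷ as) = con a :+ X :* monic as

  monicProduct : List (List ℤ) → ℤ[X]
  monicProduct []       = con 1ℤ
  monicProduct (p ∷ ps) = monic p :* monicProduct ps

  -- The columns of P are eigenvectors of N, and Q = Δ P⁻¹.
  record Eigenbasis {n} (N : PolyMatrix n) : Set (c ⊔ ℓ) where
    field
      P Q         : PolyMatrix n
      eigenvalue  : Fin n → ℤ[X]
      exponent    : ℕ
      factors     : List (List ℤ)

    Δ : ℤ[X]
    Δ = con (+ 2) :^ exponent :* monicProduct factors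

    field
      PQ≋Δ  : (P ⊗P Q) ≋P diagP (λ _ → Δ)
      QP≋Δ  : (Q ⊗P P) ≋P diagP (λ _ → Δ)
      PDQ≋N : ((P ⊗P diagP eigenvalue) ⊗P Q) ≋P λ a b → Δ :* N a b

  -- With X² = t^(q - 1), the columns of M(j,n,q,t) up to the common factor t^(j + 1).
  scaleColumns : ∀ {n} → (Fin n → Fin n → ℤ) → PolyMatrix n
  scaleColumns m a b = con (m a b) :* X :^ (2 ℕ.* toℕ b)

  private
    table : ∀ {n} → Vec (Vec ℤ[X] n) n → PolyMatrix n
    table rows a b = lookup (lookup rows a) b

    0′ 1′ 2′ 3′ 4′ 6′ : ℤ[X]
    0′ = con 0ℤ
    1′ = con 1ℤ
    2′ = con (+ 2)
    3′ = con (+ 3)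
    4′ = con (+ 4)
    6′ = con (+ 6)

  -- Under `from-just` the three identities are expanded and compared during type checking, so the
  -- tables below carry their own proof.
  certify : ∀ {n} (N P Q : PolyMatrix n) (d : Fin n → ℤ[X]) (e : ℕ) (ps : List (List ℤ)) → Maybe (Eigenbasis N)
  certify N P Q d e ps
    with (P ⊗P Q) ≋P? diagP (λ _ → con (+ 2) :^ e :* monicProduct ps)
       | (Q ⊗P P) ≋P? diagP (λ _ → con (+ 2) :^ e :* monicProduct ps)
       | ((P ⊗P diagP d) ⊗P Q) ≋P? (λ a b → (con (+ 2) :^ e :* monicProduct ps) :* N a b)
  ... | just pq | just qp | just pdq = just record
    { P = P ; Q = Q ; eigenvalue = d ; exponent = e ; factors = ps
    ; PQ≋Δ = pq ; QP≋Δ = qp ; PDQ≋N = pdq }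
  ... | _ | _ | _ = nothing

  -- Explicit eigenbases

  private
    u X³ X⁵ : ℤ[X]
    u  = X :* X
    X³ = X :* u
    X⁵ = X³ :* u

    -- The n × n matrices with (a , n + 1 - a) entry σ X^(2 (n - a)) and zeros elsewhere.
    antidiagonal₂ : ∀ N σ → Maybe (Eigenbasis N)
    antidiagonal₂ N σ = certify N
      (table ((X  ∷ X    ∷ []) ∷
              (1′ ∷ :- 1′ ∷ []) ∷ []))
      (table ((1′ ∷ X    ∷ []) ∷
              (1′ ∷ :- X ∷ []) ∷ []))
      (λ a → con σ :* lookup (X ∷ :- X ∷ []) a)
      1 ((0ℤ ∷ []) ∷ [])

    antidiagonal₃ : ∀ N σ → Maybe (Eigenbasis N)
    antidiagonal₃ N σ = certify N
      (table ((u  ∷ 0′ ∷ u     ∷ []) ∷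
              (0′ ∷ 1′ ∷ 0′    ∷ []) ∷
              (1′ ∷ 0′ ∷ :- 1′ ∷ []) ∷ []))
      (table ((1′ ∷ 0′      ∷ u    ∷ []) ∷
              (0′ ∷ 2′ :* u ∷ 0′   ∷ []) ∷
              (1′ ∷ 0′      ∷ :- u ∷ []) ∷ []))
      (λ a → con σ :* lookup (u ∷ u ∷ :- u ∷ []) a)
      1 ((0ℤ ∷ 0ℤ ∷ []) ∷ [])

    -- For a = 1, 2 the coordinates a and 5 - a span an invariant plane with eigenvectors (X^(5 -
    -- 2a), ±1) and eigenvalues ±σ X^3.
    antidiagonal₄ : ∀ N σ → Maybe (Eigenbasis N)
    antidiagonal₄ N σ = certify N
      (table ((X³ ∷ X³    ∷ 0′ ∷ 0′    ∷ []) ∷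
              (0′ ∷ 0′    ∷ X  ∷ X     ∷ []) ∷
              (0′ ∷ 0′    ∷ 1′ ∷ :- 1′ ∷ []) ∷
              (1′ ∷ :- 1′ ∷ 0′ ∷ 0′    ∷ []) ∷ []))
      (table ((1′ ∷ 0′ ∷ 0′    ∷ X³    ∷ []) ∷
              (1′ ∷ 0′ ∷ 0′    ∷ :- X³ ∷ []) ∷
              (0′ ∷ u  ∷ X³    ∷ 0′    ∷ []) ∷
              (0′ ∷ u  ∷ :- X³ ∷ 0′    ∷ []) ∷ []))
      (λ a → con σ :* lookup (X³ ∷ :- X³ ∷ X³ ∷ :- X³ ∷ []) a)
      1 ((0ℤ ∷ 0ℤ ∷ 0ℤ ∷ []) ∷ [])

  eigenbasis-2-0 : Eigenbasis (scaleColumns (Mℤ 0 2 1ℤ))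
  eigenbasis-2-0 = from-just (certify (scaleColumns (Mℤ 0 2 1ℤ))
    (table ((1′ ∷ 0′ ∷ []) ∷
            (1′ ∷ 1′ ∷ []) ∷ []))
    (table ((1′    ∷ 0′ ∷ []) ∷
            (:- 1′ ∷ 1′ ∷ []) ∷ []))
    (lookup (1′ ∷ 0′ ∷ []))
    0 [])

  -- Writing the index as 1 + j lets every comparison in `blockC` reduce while j is a variable, so
  -- one certificate serves all j. The sign (-1)^j does not reduce, hence the pair.
  eigenbasis-2-≥1 : ∀ j → Eigenbasis (scaleColumns (Mℤ (1 ℕ.+ j) 2 1ℤ)) × Eigenbasis (scaleColumns (Mℤ (1 ℕ.+ j) 2 -1ℤ))
  eigenbasis-2-≥1 j = from-just (antidiagonal₂ (scaleColumns (Mℤ (1 ℕ.+ j) 2 1ℤ)) 1ℤ) , from-just (antidiagonal₂ (scaleColumns (Mℤ (1 ℕ.+ j) 2 -1ℤ)) -1ℤ)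

  eigenbasis-3-0 : Eigenbasis (scaleColumns (Mℤ 0 3 1ℤ))
  eigenbasis-3-0 = from-just (certify (scaleColumns (Mℤ 0 3 1ℤ))
    (table ((1′      ∷ 0′ ∷ 0′ ∷ []) ∷
            (1′ :+ u ∷ 1′ ∷ u  ∷ []) ∷
            (1′      ∷ 0′ ∷ 1′ ∷ []) ∷ []))
    (table ((1′    ∷ 0′ ∷ 0′   ∷ []) ∷
            (:- 1′ ∷ 1′ ∷ :- u ∷ []) ∷
            (:- 1′ ∷ 0′ ∷ 1′   ∷ []) ∷ []))
    (lookup (1′ ∷ u ∷ 0′ ∷ []))
    0 [])

  -- The single factor X^2 + 1 is the difference of the eigenvalues 1 and -u.
  eigenbasis-3-1 : Eigenbasis (scaleColumns (Mℤ 1 3 -1ℤ))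
  eigenbasis-3-1 = from-just (certify (scaleColumns (Mℤ 1 3 -1ℤ))
    (table ((1′    ∷ 2′ :* u ∷ 0′ ∷ []) ∷
            (0′    ∷ 1′ :+ u ∷ 0′ ∷ []) ∷
            (:- 1′ ∷ 2′      ∷ 1′ ∷ []) ∷ []))
    (table ((1′ :+ u ∷ :- (2′ :* u)         ∷ 0′      ∷ []) ∷
            (0′      ∷ 1′                   ∷ 0′      ∷ []) ∷
            (1′ :+ u ∷ :- (2′ :* (1′ :+ u)) ∷ 1′ :+ u ∷ []) ∷ []))
    (lookup (1′ ∷ :- u ∷ 0′ ∷ []))
    0 ((1ℤ ∷ 0ℤ ∷ []) ∷ []))

  eigenbasis-3-≥2 : ∀ j → Eigenbasis (scaleColumns (Mℤ (2 ℕ.+ j) 3 1ℤ)) × Eigenbasis (scaleColumns (Mℤ (2 ℕ.+ j) 3 -1ℤ))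
  eigenbasis-3-≥2 j = from-just (antidiagonal₃ (scaleColumns (Mℤ (2 ℕ.+ j) 3 1ℤ)) 1ℤ) , from-just (antidiagonal₃ (scaleColumns (Mℤ (2 ℕ.+ j) 3 -1ℤ)) -1ℤ)

  -- The second and third coordinates span an invariant plane with an antidiagonal block, whence
  -- ±X^3; the quotient by it contributes 1 and 0.
  eigenbasis-4-0 : Eigenbasis (scaleColumns (Mℤ 0 4 1ℤ))
  eigenbasis-4-0 = from-just (certify (scaleColumns (Mℤ 0 4 1ℤ))
    (table ((1′      ∷ 0′     ∷ 0′ ∷ 0′    ∷ []) ∷
            (1′ :+ u :* u ∷ u :* u ∷ X  ∷ X     ∷ []) ∷
            (1′ :+ u ∷ u ∷ 1′ ∷ :- 1′ ∷ []) ∷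
            (1′      ∷ 1′     ∷ 0′ ∷ 0′    ∷ []) ∷ []))
    (table ((2′ :* X    ∷ 0′ ∷ 0′   ∷ 0′      ∷ []) ∷
            (:- 2′ :* X ∷ 0′ ∷ 0′   ∷ 2′ :* X ∷ []) ∷
            (:- 1′ :- X ∷ 1′ ∷ X    ∷ :- (u :* u) :- X :* u ∷ []) ∷
            (X :- 1′    ∷ 1′ ∷ :- X ∷ X :* u :- u :* u ∷ []) ∷ []))
    (lookup (1′ ∷ 0′ ∷ X³ ∷ :- X³ ∷ []))
    1 ((0ℤ ∷ []) ∷ []))

  -- The eigenvalue 2 - u meets 0 where X^2 = 2. It meets X^3 where (1 - X) f₊ = 0, and -X^3 where
  -- (1 + X) f₋ = 0; the product f₊ f₋ is the factor X^4 + 4. The subscript minus marks the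
  -- substitution X ↦ -X.
  eigenbasis-4-1 : Eigenbasis (scaleColumns (Mℤ 1 4 -1ℤ))
  eigenbasis-4-1 = from-just (certify (scaleColumns (Mℤ 1 4 -1ℤ))
    (table ((0′ ∷ 2′ :* (2′ :- u) ∷ X³      ∷ :- X³        ∷ []) ∷
            (0′ ∷ 2′ :- u         ∷ X :* w₊ ∷ :- (X :* w₋) ∷ []) ∷
            (u  ∷ :- u            ∷ :- w₊   ∷ :- w₋        ∷ []) ∷
            (2′ ∷ :- 2′           ∷ :- 1′   ∷ :- 1′        ∷ []) ∷ []))
    (table ((a₁ :+ b₁ ∷ a₂ :+ b₂ ∷ a₃ :+ b₃ ∷ a₄ :+ b₄ ∷ []) ∷
            (b₁ ∷ b₂ ∷ b₃ ∷ b₄ ∷ []) ∷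
            (:- (h :* f₋) ∷ 2′ :* h :* f₋      ∷ :- (2′ :* h :* X :* f₋) ∷ h :* X³ :* f₋ ∷ []) ∷
            (h :* f₊      ∷ :- (2′ :* h :* f₊) ∷ :- (2′ :* h :* X :* f₊) ∷ h :* X³ :* f₊ ∷ []) ∷ []))
    (lookup (0′ ∷ 2′ :- u ∷ X³ ∷ :- X³ ∷ []))
    1 ((0ℤ ∷ []) ∷ (ℤ.- (+ 2) ∷ 0ℤ ∷ []) ∷ (+ 4 ∷ 0ℤ ∷ 0ℤ ∷ 0ℤ ∷ []) ∷ []))
    where
    w₊ = 1′ :+ u :+ X
    w₋ = 1′ :+ u :- X
    f₊ = 2′ :+ u :+ 2′ :* X
    f₋ = 2′ :+ u :- 2′ :* X
    h = u :- 2′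
    y = 2′ :* u :* u :+ 2′ :* u :+ 4′
    -- Up to the factor Δ, a and b are the coordinates of the unit vectors along the first column of
    -- P and along the sum of its first two columns, the sparser vector (2 (2 - u), 2 - u, 0, 0).
    -- Along the columns themselves these become a + b and b.
    a₁ = 2′ :* X :* h
    a₂ = :- (4′ :* X :* h)
    a₃ = :- (2′ :* X :* h :* (2′ :+ u))
    a₄ = X :* h :* y
    b₁ = :- (X :* y)
    b₂ = 2′ :* X³ :* (2′ :+ u)
    b₃ = 4′ :* X⁵
    b₄ = :- (2′ :* X⁵ :* u)

  -- The quadratic factors come from 1 - X^3 = (1 - X) w₊ and 1 + X^3 = (1 + X) w₋, and 2 X from the
  -- meeting of X^3 and -X^3. The entry y is Δ itself.
  eigenbasis-4-2 : Eigenbasis (scaleColumns (Mℤ 2 4 1ℤ))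
  eigenbasis-4-2 = from-just (certify (scaleColumns (Mℤ 2 4 1ℤ))
    (table ((1′ ∷ 0′ ∷ 3′ :* X³ ∷ 3′ :* X³ ∷ []) ∷
            (0′ ∷ 0′ ∷ X :* w₊  ∷ X :* w₋  ∷ []) ∷
            (0′ ∷ 0′ ∷ w₊       ∷ :- w₋    ∷ []) ∷
            (1′ ∷ 1′ ∷ 3′       ∷ :- 3′    ∷ []) ∷ []))
    (table ((y    ∷ :- (6′ :* X³ :* (1′ :+ u)) ∷ 6′ :* X⁵       ∷ 0′ ∷ []) ∷
            (:- y ∷ 6′ :* X³ :* (1′ :+ u) :+ 6′ :* X ∷ :- (6′ :* X⁵) :- 6′ :* X :* (1′ :+ u) ∷ y ∷ []) ∷
            (0′   ∷ w₋                         ∷ X :* w₋        ∷ 0′ ∷ []) ∷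
            (0′   ∷ w₊                         ∷ :- (X :* w₊)   ∷ 0′ ∷ []) ∷ []))
    (lookup (1′ ∷ 0′ ∷ X³ ∷ :- X³ ∷ []))
    1 ((0ℤ ∷ []) ∷ (1ℤ ∷ 1ℤ ∷ []) ∷ (1ℤ ∷ -1ℤ ∷ []) ∷ []))
    where
    w₊ = 1′ :+ u :+ X
    w₋ = 1′ :+ u :- X
    y = 2′ :* X :* w₊ :* w₋

  eigenbasis-4-≥3 : ∀ j → Eigenbasis (scaleColumns (Mℤ (3 ℕ.+ j) 4 1ℤ)) × Eigenbasis (scaleColumns (Mℤ (3 ℕ.+ j) 4 -1ℤ))
  eigenbasis-4-≥3 j = from-just (antidiagonal₄ (scaleColumns (Mℤ (3 ℕ.+ j) 4 1ℤ)) 1ℤ) , from-just (antidiagonal₄ (scaleColumns (Mℤ (3 ℕ.+ j) 4 -1ℤ)) -1ℤ)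

-- From eigenbases over ℤ[X] to diagonalizability over a field

module Diagonalization (F : Field c ℓ) where
  open Field F hiding (zero)
  open IntegerPolynomials F
  open import Algebra.Properties.Semiring.Sum semiring using (sum; sum-cong-≋; *-distribˡ-sum)
  open import Algebra.Properties.CommutativeSemigroup *-commutativeSemigroup using (x∙yz≈y∙xz)
  open import Relation.Binary.Reasoning.Setoid setoid

  diag-cong : ∀ {n} {d e : Fin n → Carrier} → (∀ a → d a ≈ e a) → _≋_ F (diag F d) (diag F e)
  diag-cong d≈e a b with a ≟ b
  ... | yes _ = d≈e a
  ... | no  _ = refl

  diag-scale : ∀ {n} x (d : Fin n → Carrier) → _≋_ F (λ a b → x * diag F d a b) (diag F (λ a → x * d a))
  diag-scale x d a b with a ≟ b
  ... | yes _ = refl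
  ... | no  _ = zeroʳ x

  ⊗-cong : ∀ {n} {A A′ B B′ : Matrix F n} → _≋_ F A A′ → _≋_ F B B′ → _≋_ F (_⊗_ F A B) (_⊗_ F A′ B′)
  ⊗-cong {n} A≋A′ B≋B′ a b = sum-cong-≋ {n} (λ i → *-cong (A≋A′ a i) (B≋B′ i b))

  ⊗-scaleʳ : ∀ {n} x (A B : Matrix F n) → _≋_ F (_⊗_ F A (λ a b → x * B a b)) (λ a b → x * (_⊗_ F A B) a b)
  ⊗-scaleʳ {n} x A B a b = begin
    sum (λ i → A a i * (x * B i b))    ≈⟨ sum-cong-≋ {n} (λ i → x∙yz≈y∙xz (A a i) x (B i b)) ⟩
    sum (λ i → x * (A a i * B i b))    ≈⟨ *-distribˡ-sum {n} x (λ i → A a i * B i b) ⟨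
    x * sum (λ i → A a i * B i b)      ∎

  ⊗-scaleˡ : ∀ {n} x (A B : Matrix F n) → _≋_ F (_⊗_ F (λ a b → x * A a b) B) (λ a b → x * (_⊗_ F A B) a b)
  ⊗-scaleˡ {n} x A B a b = begin
    sum (λ i → x * A a i * B i b)      ≈⟨ sum-cong-≋ {n} (λ i → *-assoc x (A a i) (B i b)) ⟩
    sum (λ i → x * (A a i * B i b))    ≈⟨ *-distribˡ-sum {n} x (λ i → A a i * B i b) ⟨
    x * sum (λ i → A a i * B i b)      ∎

  -- Dividing Q(r) by Δ(r) inverts P(r). The scalar x, which will be t^(j + 1), affects only the
  -- eigenvalues.
  eigenbasis⇒diagonalizable : ∀ {n} {N : PolyMatrix n} (E : Eigenbasis N) {r} →
    ¬ (Eigenbasis.Δ E ⟨ r ⟩ ≈ 0#) →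
    ∀ {A : Matrix F n} {x} → (∀ a b → A a b ≈ x * N a b ⟨ r ⟩) → Diagonalizable F A
  eigenbasis⇒diagonalizable {n} {N} E {r} Δ≉0 {A} {x} A≈xN =
    Pᵣ , (λ a b → δ⁻¹ * Qᵣ a b) , (λ a → x * eigenvalue a ⟨ r ⟩) , PP⁻¹≋1 , P⁻¹P≋1 , A≋PDP⁻¹
    where
    open Eigenbasis E
    Pᵣ Qᵣ Dᵣ : Matrix F n
    Pᵣ = P ⟪ r ⟫
    Qᵣ = Q ⟪ r ⟫
    Dᵣ = diag F (λ a → eigenvalue a ⟨ r ⟩)
    δ δ⁻¹ : Carrier
    δ = Δ ⟨ r ⟩
    δ⁻¹ = proj₁ (invertible Δ≉0)
    δ⁻¹δ≈1 : δ⁻¹ * δ ≈ 1#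
    δ⁻¹δ≈1 = proj₁ (proj₂ (invertible Δ≉0))

    δ⁻¹Δ≋1 : ∀ a b → δ⁻¹ * (diagP (λ _ → Δ) ⟪ r ⟫) a b ≈ 𝟙 F a b
    δ⁻¹Δ≋1 a b = begin
      δ⁻¹ * (diagP (λ _ → Δ) ⟪ r ⟫) a b   ≡⟨ ≡.cong (δ⁻¹ *_) (diagP-eval (λ _ → Δ) r a b) ⟩
      δ⁻¹ * diag F (λ _ → δ) a b          ≈⟨ diag-scale δ⁻¹ (λ _ → δ) a b ⟩
      diag F (λ _ → δ⁻¹ * δ) a b          ≈⟨ diag-cong (λ _ → δ⁻¹δ≈1) a b ⟩
      𝟙 F a b                             ∎

    PP⁻¹≋1 : _≋_ F (_⊗_ F Pᵣ (λ a b → δ⁻¹ * Qᵣ a b)) (𝟙 F)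
    PP⁻¹≋1 a b = begin
      (_⊗_ F Pᵣ (λ a b → δ⁻¹ * Qᵣ a b)) a b  ≈⟨ ⊗-scaleʳ δ⁻¹ Pᵣ Qᵣ a b ⟩
      δ⁻¹ * (_⊗_ F Pᵣ Qᵣ) a b                ≡⟨ ≡.cong (δ⁻¹ *_) (⊗P-eval P Q r a b) ⟨
      δ⁻¹ * (P ⊗P Q) a b ⟨ r ⟩               ≈⟨ *-congˡ (PQ≋Δ a b r) ⟩
      δ⁻¹ * (diagP (λ _ → Δ) ⟪ r ⟫) a b      ≈⟨ δ⁻¹Δ≋1 a b ⟩
      𝟙 F a b                                ∎

    P⁻¹P≋1 : _≋_ F (_⊗_ F (λ a b → δ⁻¹ * Qᵣ a b) Pᵣ) (𝟙 F)
    P⁻¹P≋1 a b = begin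
      (_⊗_ F (λ a b → δ⁻¹ * Qᵣ a b) Pᵣ) a b  ≈⟨ ⊗-scaleˡ δ⁻¹ Qᵣ Pᵣ a b ⟩
      δ⁻¹ * (_⊗_ F Qᵣ Pᵣ) a b                ≡⟨ ≡.cong (δ⁻¹ *_) (⊗P-eval Q P r a b) ⟨
      δ⁻¹ * (Q ⊗P P) a b ⟨ r ⟩               ≈⟨ *-congˡ (QP≋Δ a b r) ⟩
      δ⁻¹ * (diagP (λ _ → Δ) ⟪ r ⟫) a b      ≈⟨ δ⁻¹Δ≋1 a b ⟩
      𝟙 F a b                                ∎

    PxD≋xPD : _≋_ F (_⊗_ F Pᵣ (diag F (λ a → x * eigenvalue a ⟨ r ⟩))) (λ a b → x * (P ⊗P diagP eigenvalue) a b ⟨ r ⟩)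
    PxD≋xPD a b = begin
      (_⊗_ F Pᵣ (diag F (λ a → x * eigenvalue a ⟨ r ⟩))) a b
        ≈⟨ ⊗-cong {A = Pᵣ} (λ _ _ → refl) (λ i k → trans
             (sym (diag-scale x (λ a → eigenvalue a ⟨ r ⟩) i k))
             (*-congˡ (reflexive (≡.sym (diagP-eval eigenvalue r i k))))) a b ⟩
      (_⊗_ F Pᵣ (λ a b → x * (diagP eigenvalue ⟪ r ⟫) a b)) a b
        ≈⟨ ⊗-scaleʳ x Pᵣ (diagP eigenvalue ⟪ r ⟫) a b ⟩
      x * (_⊗_ F Pᵣ (diagP eigenvalue ⟪ r ⟫)) a b
        ≡⟨ ≡.cong (x *_) (⊗P-eval P (diagP eigenvalue) r a b) ⟨
      x * (P ⊗P diagP eigenvalue) a b ⟨ r ⟩ ∎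

    A≋PDP⁻¹ : _≋_ F A (_⊗_ F (_⊗_ F Pᵣ (diag F (λ a → x * eigenvalue a ⟨ r ⟩))) (λ a b → δ⁻¹ * Qᵣ a b))
    A≋PDP⁻¹ a b = sym (begin
      (_⊗_ F (_⊗_ F Pᵣ (diag F (λ a → x * eigenvalue a ⟨ r ⟩))) (λ a b → δ⁻¹ * Qᵣ a b)) a b
        ≈⟨ ⊗-scaleʳ δ⁻¹ (_⊗_ F Pᵣ (diag F (λ a → x * eigenvalue a ⟨ r ⟩))) Qᵣ a b ⟩
      δ⁻¹ * (_⊗_ F (_⊗_ F Pᵣ (diag F (λ a → x * eigenvalue a ⟨ r ⟩))) Qᵣ) a b
        ≈⟨ *-congˡ (⊗-cong {B = Qᵣ} PxD≋xPD (λ _ _ → refl) a b) ⟩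
      δ⁻¹ * (_⊗_ F (λ a b → x * (P ⊗P diagP eigenvalue) a b ⟨ r ⟩) Qᵣ) a b
        ≈⟨ *-congˡ (⊗-scaleˡ x ((P ⊗P diagP eigenvalue) ⟪ r ⟫) Qᵣ a b) ⟩
      δ⁻¹ * (x * (_⊗_ F ((P ⊗P diagP eigenvalue) ⟪ r ⟫) Qᵣ) a b)
        ≡⟨ ≡.cong (λ y → δ⁻¹ * (x * y)) (⊗P-eval (P ⊗P diagP eigenvalue) Q r a b) ⟨
      δ⁻¹ * (x * ((P ⊗P diagP eigenvalue) ⊗P Q) a b ⟨ r ⟩)
        ≈⟨ *-congˡ (*-congˡ (PDQ≋N a b r)) ⟩
      δ⁻¹ * (x * (δ * N a b ⟨ r ⟩))
        ≈⟨ *-congˡ (x∙yz≈y∙xz x δ _) ⟩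
      δ⁻¹ * (δ * (x * N a b ⟨ r ⟩))
        ≈⟨ *-assoc δ⁻¹ δ _ ⟨
      δ⁻¹ * δ * (x * N a b ⟨ r ⟩)
        ≈⟨ trans (*-congʳ δ⁻¹δ≈1) (*-identityˡ _) ⟩
      x * N a b ⟨ r ⟩
        ≈⟨ A≈xN a b ⟨
      A a b ∎)

-- Absolute values

+₋-≤0 : ∀ {u v} → u ≤₋ [ 0ℚ ] → v ≤₋ [ 0ℚ ] → (u +₋ v) ≤₋ [ 0ℚ ]
+₋-≤0 (⊥₋≤ _) _        = ⊥₋≤ _
+₋-≤0 [ _ ]   (⊥₋≤ _)  = ⊥₋≤ _
+₋-≤0 [ r≤0 ] [ s≤0 ]  = [ ℚ.+-mono-≤ r≤0 s≤0 ]

+₋-≰0 : ∀ {u v} → ¬ (u ≤₋ [ 0ℚ ]) → ¬ (v ≤₋ [ 0ℚ ]) → ¬ ((u +₋ v) ≤₋ [ 0ℚ ])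
+₋-≰0 {⊥₋}    {_}     u≰0 _   _ = u≰0 (⊥₋≤ _)
+₋-≰0 {[ _ ]} {⊥₋}    _   v≰0 _ = v≰0 (⊥₋≤ _)
+₋-≰0 {[ r ]} {[ s ]} u≰0 v≰0 [ r+s≤0 ] =
  ℚ.<-irrefl ≡.refl (ℚ.<-≤-trans (ℚ.+-mono-< (ℚ.≰⇒> (λ r≤0 → u≰0 [ r≤0 ])) (ℚ.≰⇒> (λ s≤0 → v≰0 [ s≤0 ]))) r+s≤0)

module ValuationRing {F : Field c ℓ} (V : AbsoluteValue F) where
  open Field F hiding (zero)
  open AbsoluteValue V
  open Integers commutativeRing
  open FieldProperties F
  open IntegerPolynomials F using (_⟨_⟩; monic; monicProduct; Eigenbasis)
  open import Algebra.Properties.Ring ring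
  open import Algebra.Properties.Semiring.Mult semiring using () renaming (_×_ to _·_)
  open import Relation.Binary.Reasoning.Setoid setoid
  open import Algebra.Properties.Semiring.Exp semiring using (_^_)

  Integral : Carrier → Set
  Integral x = deg x ≤₋ [ 0ℚ ]

  integral-cong : ∀ {x y} → x ≈ y → Integral x → Integral y
  integral-cong x≈y = ≡.subst (_≤₋ [ 0ℚ ]) (deg-cong x≈y)

  integral-* : ∀ {x y} → Integral x → Integral y → Integral (x * y)
  integral-* {x} {y} ox oy = ≡.subst (_≤₋ [ 0ℚ ]) (≡.sym (deg-* x y)) (+₋-≤0 ox oy)

  ¬integral-* : ∀ {x y} → ¬ Integral x → ¬ Integral y → ¬ Integral (x * y)
  ¬integral-* {x} {y} ¬ox ¬oy oxy = +₋-≰0 ¬ox ¬oy (≡.subst (_≤₋ [ 0ℚ ]) (deg-* x y) oxy)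

  integral-0 : Integral 0#
  integral-0 = ≡.subst (_≤₋ [ 0ℚ ]) (≡.sym deg-0) (⊥₋≤ _)

  integral-√ : ∀ {x} → Integral (x * x) → Integral x
  integral-√ {x} oxx with ≤₋-dec ℚ._≤?_ (deg x) [ 0ℚ ]
  ... | yes ox = ox
  ... | no ¬ox = contradiction oxx (¬integral-* ¬ox ¬ox)

  -- The equation deg 1 + deg 1 = deg 1 leaves only the values `⊥₋` and 0.
  integral-1 : Integral 1#
  integral-1 = idempotent⇒≤0 (deg 1#) (≡.trans (≡.sym (deg-* 1# 1#)) (deg-cong (*-identityˡ 1#)))
    where
    idempotent⇒≤0 : ∀ u → u +₋ u ≡ u → u ≤₋ [ 0ℚ ]
    idempotent⇒≤0 ⊥₋    _      = ⊥₋≤ _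
    idempotent⇒≤0 [ r ] r+r≡r = [ ℚ.≤-reflexive (identityʳ-unique r r ([]-injective r+r≡r)) ]
      where open Algebra.Properties.Group ℚ.+-0-group using (identityʳ-unique)

  -- It suffices to treat -1, whose square 1 is integral.
  integral-neg : ∀ {x} → Integral x → Integral (- x)
  integral-neg ox = integral-cong (-1*x≈-x _) (integral-* integral--1 ox)
    where
    integral--1 : Integral (- 1#)
    integral--1 = integral-√ (integral-cong (sym (trans (-1*x≈-x (- 1#)) (-‿involutive 1#))) integral-1)

  integral-ℕ : ∀ n → Integral (n · 1#)
  integral-ℕ zero    = integral-0
  integral-ℕ (suc n) = deg-+ integral-1 (integral-ℕ n)

  integral-ℤ : ∀ i → Integral (fromℤ i)
  integral-ℤ (+ n)    = integral-ℕ n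
  integral-ℤ -[1+ n ] = integral-neg (integral-ℕ (suc n))

  integral-cancelˡ : ∀ {x y} → Integral x → Integral (x + y) → Integral y
  integral-cancelˡ {x} {y} ox oxy = integral-cong (begin
    - x + (x + y)   ≈⟨ +-assoc (- x) x y ⟨
    - x + x + y     ≈⟨ +-congʳ (-‿inverseˡ x) ⟩
    0# + y          ≈⟨ +-identityˡ y ⟩
    y               ∎) (deg-+ (integral-neg ox) oxy)

  ¬integral-^ : ∀ {x} → ¬ Integral x → ∀ n → 0 < n → ¬ Integral (x ^ n)
  ¬integral-^ ¬ox 1             _ = λ ox1 → ¬ox (integral-cong (*-identityʳ _) ox1)
  ¬integral-^ ¬ox (suc (suc n)) _ = ¬integral-* ¬ox (¬integral-^ ¬ox (suc n) (s≤s z≤n))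

  module _ {r : Carrier} (¬or : ¬ Integral r) where

    -- The valuation ring is integrally closed, so r is no root of a monic integer polynomial.
    ¬integral-r*monic : ∀ p → ¬ Integral (r * monic p ⟨ r ⟩)
    ¬integral-r*monic []       o = ¬or (integral-cong (trans (*-congˡ fromℤ-1) (*-identityʳ r)) o)
    ¬integral-r*monic (a ∷ as) = ¬integral-* ¬or
      (λ o → ¬integral-r*monic as (integral-cancelˡ (integral-ℤ a) o))

    -- At a root, r times the value would be 0, which is integral. The extra factor r starts the
    -- induction behind this: the empty list gives the polynomial 1, whose value is integral, while
    -- r is not.
    monic-nonzero : ∀ p → ¬ (monic p ⟨ r ⟩ ≈ 0#)
    monic-nonzero p p≈0 = ¬integral-r*monic p
      (integral-cong (sym (trans (*-congˡ p≈0) (zeroʳ r))) integral-0)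

    monicProduct-nonzero : ∀ ps → ¬ (monicProduct ps ⟨ r ⟩ ≈ 0#)
    monicProduct-nonzero []       1≈0 = 1≉0 (trans (sym fromℤ-1) 1≈0)
    monicProduct-nonzero (p ∷ ps) = *-nonzero (monic-nonzero p) (monicProduct-nonzero ps)

    Δ-nonzero : ¬ (2 · 1# ≈ 0#) → ∀ {n N} (E : Eigenbasis {n} N) → ¬ (Eigenbasis.Δ E ⟨ r ⟩ ≈ 0#)
    Δ-nonzero 2≉0 E = *-nonzero (^-nonzero 2≉0 exponent) (monicProduct-nonzero factors)
      where open Eigenbasis E

-- Square roots and constant Laurent series

module _ (F : Field c ℓ) where
  open Field F hiding (zero)
  open import Algebra.Properties.Ring ring using (-‿involutive)
  open import Algebra.Properties.Group +-group using (inverseʳ-unique)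
  open import Relation.Binary.Reasoning.Setoid setoid

  squareRoot : AlgebraicallyClosed F → ∀ y → ∃[ x ] x * x ≈ y
  squareRoot closed y = x , trans (inverseʳ-unique (- y) (x * x) -y+x²≈0) (-‿involutive y)
    where
    a : Fin 3 → Carrier
    a = lookup (- y ∷ 0# ∷ 1# ∷ [])
    x : Carrier
    -- The index 1 stands for degree 2; `1≉0` is the condition on the leading coefficient of X^2 -
    -- y.
    x = proj₁ (closed 1 a 1≉0)
    -y+x²≈0 : - y + x * x ≈ 0#
    -y+x²≈0 = begin
      - y + x * x                                             ≈⟨ +-cong (*-identityʳ (- y)) (+-identityˡ (x * x)) ⟨
      - y * 1# + (0# + x * x)                                 ≈⟨ +-congˡ (+-cong (zeroˡ (x * 1#)) (*-congˡ (*-identityʳ x))) ⟨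
      - y * 1# + (0# * (x * 1#) + x * (x * 1#))               ≈⟨ +-congˡ (+-congˡ (trans (+-identityʳ _) (*-identityˡ _))) ⟨
      - y * 1# + (0# * (x * 1#) + (1# * (x * (x * 1#)) + 0#)) ≈⟨ proj₂ (closed 1 a 1≉0) ⟩
      0#                                                      ∎

module LaurentConstants (F : Field c ℓ) where
  open Field F hiding (zero)
  open import Algebra.Properties.Ring ring using (-0#≈0#)

  private
    module L = RawRing (laurentRing F)

  constant-cong : ∀ {x y} → x ≈ y → constant F x L.≈ constant F y
  constant-cong x≈y k with + 0 ℤ.- k
  ... | + zero    = x≈y
  ... | + suc _   = refl
  ... | -[1+ _ ]  = refl

  constant-+ : ∀ x y → constant F (x + y) L.≈ constant F x L.+ constant F y
  constant-+ x y k with + 0 ℤ.- k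
  ... | + zero    = refl
  ... | + suc _   = sym (+-identityˡ 0#)
  ... | -[1+ _ ]  = refl

  constant-neg : ∀ x → constant F (- x) L.≈ L.- constant F x
  constant-neg x k with + 0 ℤ.- k
  ... | + zero    = refl
  ... | + suc _   = sym -0#≈0#
  ... | -[1+ _ ]  = refl

  t-degree : HasDegree F (t F) (+ 1)
  t-degree = Field.1≉0 F , λ { _ (ℤ.+<+ (s≤s (s≤s _))) → refl }

-- In ℂ∞

module _ {a m c₁ ℓ₁ c₂ ℓ₂} {𝔽q : Field a m} (C : ℂ∞-Over 𝔽q c₁ ℓ₁ c₂ ℓ₂) where
  private
    module 𝔽 = Field 𝔽q
    module 𝔽ℤ = Integers 𝔽.commutativeRing
    module L = RawRing (laurentRing 𝔽q)
    module L^ = Algebra.Definitions.RawSemiring L.rawSemiring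
    open ℂ∞-Over C
    open AlgebraicClosure algebraicClosure using (closure; algebraicallyClosed)
      renaming (embed to embedLaurent; isRingMonomorphism to embedLaurent-mono)
    open Completion isCompletion using (isometric) renaming (absoluteValue to V; isRingMonomorphism to embed-mono)
    module K = Field closure
  open Field ℂ∞ hiding (zero)
  open Integers commutativeRing
  open IntegerPolynomials ℂ∞
  open LaurentConstants 𝔽q
  open import Algebra.Properties.Semiring.Mult semiring using () renaming (_×_ to _·_)
  open import Algebra.Properties.Semiring.Exp semiring using (_^_; ^-congˡ; ^-congʳ; ^-homo-*; ^-assocʳ)
  open import Relation.Binary.Reasoning.Setoid setoid

  ι-mono : RingMorphisms.IsRingMonomorphism (laurentRing 𝔽q) rawRing ι
  ι-mono = Composition.isRingMonomorphism trans embedLaurent-mono embed-mono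

  open RingMorphisms.IsRingMonomorphism ι-mono

  ι-t¬integral : ¬ ValuationRing.Integral V (ι (t 𝔽q))
  ι-t¬integral o with ≡.subst (_≤₋ [ 0ℚ ]) (≡.trans (isometric (embedLaurent (t 𝔽q))) (extends (t 𝔽q) (+ 1) t-degree)) o
  ... | [ ℚ.*≤* (ℤ.+≤+ ()) ]

  -- Roots are supplied by the algebraic closure, not by its completion, so the root is extracted
  -- before embedding.
  √ι-t : ∃[ s ] s * s ≈ ι (t 𝔽q)
  √ι-t = embed s , trans (sym (embed.*-homo s s)) (embed.⟦⟧-cong (proj₂ root))
    where
    module embed = RingMorphisms.IsRingMonomorphism embed-mono
    root : ∃[ s ] s K.* s K.≈ embedLaurent (t 𝔽q)
    root = squareRoot closure algebraicallyClosed (embedLaurent (t 𝔽q))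
    s = proj₁ root

  ι-constant-ℕ : ∀ n → ι (constant 𝔽q (𝔽ℤ.fromℤ (+ n))) ≈ n · 1#
  ι-constant-ℕ zero    = 0#-homo
  ι-constant-ℕ (suc n) = begin
    ι (constant 𝔽q (𝔽.1# 𝔽.+ 𝔽ℤ.fromℤ (+ n)))                     ≈⟨ ⟦⟧-cong (constant-+ 𝔽.1# (𝔽ℤ.fromℤ (+ n))) ⟩
    ι (constant 𝔽q 𝔽.1# L.+ constant 𝔽q (𝔽ℤ.fromℤ (+ n)))         ≈⟨ +-homo (constant 𝔽q 𝔽.1#) (constant 𝔽q (𝔽ℤ.fromℤ (+ n))) ⟩
    ι (constant 𝔽q 𝔽.1#) + ι (constant 𝔽q (𝔽ℤ.fromℤ (+ n)))       ≈⟨ +-cong 1#-homo (ι-constant-ℕ n) ⟩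
    1# + n · 1#                                                   ∎

  ι-constant-ℤ : ∀ i → ι (constant 𝔽q (𝔽ℤ.fromℤ i)) ≈ fromℤ i
  ι-constant-ℤ (+ n)    = ι-constant-ℕ n
  ι-constant-ℤ -[1+ n ] = begin
    ι (constant 𝔽q (𝔽.- 𝔽ℤ.fromℤ (+ suc n)))       ≈⟨ ⟦⟧-cong (constant-neg (𝔽ℤ.fromℤ (+ suc n))) ⟩
    ι (L.- constant 𝔽q (𝔽ℤ.fromℤ (+ suc n)))       ≈⟨ -‿homo (constant 𝔽q (𝔽ℤ.fromℤ (+ suc n))) ⟩
    - ι (constant 𝔽q (𝔽ℤ.fromℤ (+ suc n)))         ≈⟨ -‿cong (ι-constant-ℕ (suc n)) ⟩
    - (suc n · 1#)                                 ∎

  -- Injectivity of ι pulls n = 0 back to an equality of constant Laurent series, which is read at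
  -- the coefficient of t^0.
  n·1≉0 : ∀ n → ¬ (𝔽ℤ.fromℤ (+ n) 𝔽.≈ 𝔽.0#) → ¬ (n · 1# ≈ 0#)
  n·1≉0 n n≉0 n≈0 = n≉0 (injective (trans (ι-constant-ℕ n) (trans n≈0 (sym 0#-homo))) (+ 0))

  ι-^ : ∀ f n → ι (f L^.^ n) ≈ ι f ^ n
  ι-^ f zero    = 1#-homo
  ι-^ f (suc n) = trans (*-homo f (f L^.^ n)) (*-congˡ (ι-^ f n))

  module _ (j n q : ℕ) {m : Fin n → Fin n → ℤ} (M≈m : ∀ a b → M[_,_,_] 𝔽q j n q a b 𝔽.≈ 𝔽ℤ.fromℤ (m a b))
    {s : Carrier} (s*s≈ιt : s * s ≈ ι (t 𝔽q)) where

    ι-t-^ : ∀ b → ι (t 𝔽q L^.^ (j ℕ.+ 1 ℕ.+ b ℕ.* (q ∸ 1))) ≈ (s * s) ^ (j ℕ.+ 1) * (s ^ (q ∸ 1)) ^ (2 ℕ.* b)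
    ι-t-^ b = begin
      ι (t 𝔽q L^.^ (j ℕ.+ 1 ℕ.+ b ℕ.* (q ∸ 1)))                  ≈⟨ ι-^ (t 𝔽q) (j ℕ.+ 1 ℕ.+ b ℕ.* (q ∸ 1)) ⟩
      ι (t 𝔽q) ^ (j ℕ.+ 1 ℕ.+ b ℕ.* (q ∸ 1))                     ≈⟨ ^-congˡ (j ℕ.+ 1 ℕ.+ b ℕ.* (q ∸ 1)) s*s≈ιt ⟨
      (s * s) ^ (j ℕ.+ 1 ℕ.+ b ℕ.* (q ∸ 1))                      ≈⟨ ^-homo-* (s * s) (j ℕ.+ 1) _ ⟩
      (s * s) ^ (j ℕ.+ 1) * (s * s) ^ (b ℕ.* (q ∸ 1))            ≈⟨ *-congˡ (^-congˡ (b ℕ.* (q ∸ 1)) (*-congˡ (sym (*-identityʳ s)))) ⟩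
      (s * s) ^ (j ℕ.+ 1) * (s ^ 2) ^ (b ℕ.* (q ∸ 1))            ≈⟨ *-congˡ (^-assocʳ s 2 (b ℕ.* (q ∸ 1))) ⟩
      (s * s) ^ (j ℕ.+ 1) * s ^ (2 ℕ.* (b ℕ.* (q ∸ 1)))          ≈⟨ *-congˡ (^-congʳ s exponents) ⟩
      (s * s) ^ (j ℕ.+ 1) * s ^ ((q ∸ 1) ℕ.* (2 ℕ.* b))          ≈⟨ *-congˡ (^-assocʳ s (q ∸ 1) (2 ℕ.* b)) ⟨
      (s * s) ^ (j ℕ.+ 1) * (s ^ (q ∸ 1)) ^ (2 ℕ.* b)            ∎
      where
      exponents : 2 ℕ.* (b ℕ.* (q ∸ 1)) ≡ (q ∸ 1) ℕ.* (2 ℕ.* b)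
      exponents = ≡.trans (≡.sym (ℕ.*-assoc 2 b (q ∸ 1))) (ℕ.*-comm (2 ℕ.* b) (q ∸ 1))

    ι-M : ∀ a b → ι (M[_,_,_,t] 𝔽q j n q a b) ≈ (s * s) ^ (j ℕ.+ 1) * scaleColumns m a b ⟨ s ^ (q ∸ 1) ⟩
    ι-M a b = begin
      ι (M[_,_,_,t] 𝔽q j n q a b)
        ≈⟨ *-homo (constant 𝔽q (M[_,_,_] 𝔽q j n q a b)) _ ⟩
      ι (constant 𝔽q (M[_,_,_] 𝔽q j n q a b)) * ι (t 𝔽q L^.^ (j ℕ.+ 1 ℕ.+ toℕ b ℕ.* (q ∸ 1)))
        ≈⟨ *-cong (trans (⟦⟧-cong (constant-cong (M≈m a b))) (ι-constant-ℤ (m a b))) (ι-t-^ (toℕ b)) ⟩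
      fromℤ (m a b) * ((s * s) ^ (j ℕ.+ 1) * (s ^ (q ∸ 1)) ^ (2 ℕ.* toℕ b))
        ≈⟨ x∙yz≈y∙xz _ _ _ ⟩
      (s * s) ^ (j ℕ.+ 1) * (fromℤ (m a b) * (s ^ (q ∸ 1)) ^ (2 ℕ.* toℕ b)) ∎
      where
      open import Algebra.Properties.CommutativeSemigroup *-commutativeSemigroup using (x∙yz≈y∙xz)

-- The case distinction and the conclusion

module _ (F : Field c ℓ) where
  open IntegerPolynomials F

  private
    bySign : (P : ℤ → Set (c ⊔ ℓ)) → P 1ℤ × P -1ℤ → ∀ j → P (-1ℤ ℤ.^ j)
    bySign P (p₊ , p₋) j with -1ℤ ℤ.^ j | [-1]^n≡±1 j
    ... | _ | inj₁ ≡.refl = p₊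
    ... | _ | inj₂ ≡.refl = p₋

  eigenbasis : ∀ j n → 2 ≤ n → n ≤ 4 → Eigenbasis (scaleColumns (Mℤ j n (-1ℤ ℤ.^ j)))
  eigenbasis j 1 (s≤s ())
  eigenbasis 0 2 _ _ = eigenbasis-2-0
  eigenbasis 0 3 _ _ = eigenbasis-3-0
  eigenbasis 0 4 _ _ = eigenbasis-4-0
  eigenbasis 1 3 _ _ = eigenbasis-3-1
  eigenbasis 1 4 _ _ = eigenbasis-4-1
  eigenbasis 2 4 _ _ = eigenbasis-4-2
  eigenbasis (suc j) 2 _ _ = bySign (λ σ → Eigenbasis (scaleColumns (Mℤ (1 ℕ.+ j) 2 σ))) (eigenbasis-2-≥1 j) (1 ℕ.+ j)
  eigenbasis (suc (suc j)) 3 _ _ = bySign (λ σ → Eigenbasis (scaleColumns (Mℤ (2 ℕ.+ j) 3 σ))) (eigenbasis-3-≥2 j) (2 ℕ.+ j)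
  eigenbasis (suc (suc (suc j))) 4 _ _ = bySign (λ σ → Eigenbasis (scaleColumns (Mℤ (3 ℕ.+ j) 4 σ))) (eigenbasis-4-≥3 j) (3 ℕ.+ j)
  eigenbasis j (suc (suc (suc (suc (suc n))))) _ (s≤s (s≤s (s≤s (s≤s ()))))

oddPrimePower≥3 : ∀ {q} → IsPrimePower q → ¬ (2 ∣ q) → 3 ≤ q
oddPrimePower≥3 {q} (p , e , pp , ≡.refl) 2∤q = ℕ.≤∧≢⇒< 2≤q λ { 2≡q → 2∤q (≡.subst (2 ∣_) 2≡q ∣-refl) }
  where
  2≤q : 2 ≤ p ℕ.^ suc e
  2≤q = ℕ.*-mono-≤ (nonTrivial⇒n>1 p {{prime⇒nonTrivial pp}}) (ℕ.m^n>0 p {{prime⇒nonZero pp}} e)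

mainTheorem6 : ∀ {a m c₁ ℓ₁ c₂ ℓ₂ : Level}
    (q : ℕ) → IsPrimePower q → ¬ (2 ∣ q) →
    (𝔽q : Field a m) → HasCardinality 𝔽q q →
    (C : ℂ∞-Over 𝔽q c₁ ℓ₁ c₂ ℓ₂) →
    (j n : ℕ) → j ≤ q ∸ 2 → 2 ≤ n → n ≤ 4 →
    Diagonalizable (ℂ∞-Over.ℂ∞ C) (λ a b → ℂ∞-Over.ι C (M[_,_,_,t] 𝔽q j n q a b))
mainTheorem6 q pp 2∤q 𝔽q card C j n j≤q-2 2≤n n≤4 =
  eigenbasis⇒diagonalizable E (Δ-nonzero ¬integral-r 2≉0 E) (ι-M C j n q {Mℤ j n σ} M≈Mℤσ (proj₂ (√ι-t C)))
  where
  open ℂ∞-Over C using (ℂ∞; isCompletion)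
  open Diagonalization ℂ∞ using (eigenbasis⇒diagonalizable)
  open ValuationRing (Completion.absoluteValue isCompletion)
  open FiniteField 𝔽q card
  3≤q : 3 ≤ q
  3≤q = oddPrimePower≥3 pp 2∤q
  open LucasTheorem 𝔽q q (ℕ.≤-trans (s≤s z≤n) 3≤q) (binom-q-k≈0 pp)
  2+j≤q : 2 ℕ.+ j ≤ q
  2+j≤q = ≡.subst (2 ℕ.+ j ≤_) (ℕ.m+[n∸m]≡n (ℕ.<⇒≤ 3≤q)) (ℕ.+-monoʳ-≤ 2 j≤q-2)
  σ = -1ℤ ℤ.^ j
  -- The block indices go up to n - 1 ≤ 3 ≤ q, with equality for n = 4 and q = 3.
  M≈Mℤσ = M≈Mℤ 2+j≤q {σ = σ} (ℕ.≤-trans n≤4 (s≤s 3≤q)) ([-1]^n≈fromℤ j)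
  E = eigenbasis ℂ∞ j n 2≤n n≤4
  s = proj₁ (√ι-t C)
  -- If s were integral, so would be s * s, the image of t, which has degree 1. The exponent q - 1
  -- is positive.
  ¬integral-r = ¬integral-^ {s} (λ os → ι-t¬integral C (integral-cong (proj₂ (√ι-t C)) (integral-* os os))) (q ∸ 1)
    (ℕ.∸-monoˡ-≤ 1 (ℕ.<⇒≤ 3≤q))
  2≉0 = n·1≉0 C 2 (2·1≉0 2∤q)
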